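{- Let $N$ be a positive integer, let $x\in\{ -1,1\}^{\mathbb{Z}/N\mathbb{Z}}$ and $y\in\{ -1,1\}^{\mathbb{Z}}$, and suppose $\Sigma(x)=0$. For every hitomezashi loop $L$ of homology class $1$ in the cylindrical hitomezashi pattern $\mathrm{Cloth}_{\mathbb{Z}\times\mathbb{Z}/N\mathbb{Z}}(x,y)$, the bounding sequence of $L$ is minimally positively overflowing. Conversely, if $m\le M$ are integers such that $y_m,y_{m+1},\ldots,y_M$ is minimally positively overflowing, then there exists a unique hitomezashi loop $L$ of homology class $1$ in $\mathrm{Cloth}_{\mathbb{Z}\times\mathbb{Z}/N\mathbb{Z}}(x,y)$ whose bounding sequence is $y_m,y_{m+1},\ldots,y_M$. The analogous statements hold with homology class $-1$ in place of $1$ and "minimally negatively overflowing" in place of "minimally positively overflowing".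
   Context: Oriented hitomezashi pattern: for $G=\mathbb{Z}$, $H=\mathbb{Z}/N\mathbb{Z}$, $x\in\{ -1,1\}^H$, $y\in\{ -1,1\}^G$, the pattern $\mathrm{Cloth}_{G\times H}(x,y)$ is the directed graph on vertex set $G\times H$ in which, for each $(i,j)$, the (horizontal) edge between $(i,j)$ and $(i+1,j)$ is oriented $(i,j)\to(i+1,j)$ if $x_j=1$ and $(i+1,j)\to(i,j)$ if $x_j=-1$, and the (vertical) edge between $(i,j)$ and $(i,j+1)$ is oriented $(i,j)\to(i,j+1)$ if $y_i=1$ and $(i,j+1)\to(i,j)$ if $y_i=-1$. A hitomezashi path is a directed path following the orientations and alternating between horizontal and vertical edges; a hitomezashi loop is a closed directed circuit following the orientations and alternating between horizontal and vertical edges. The homology class of a loop $L$ is $\Delta y/N$, where $\Delta y$ is the number of edges of $L$ of the form $(i,j)\to(i,j+1)$ minus the number of edges of $L$ of the form $(i,j+1)\to(i,j)$. Sums: for a sequence $z\in\{ -1,1\}^{\mathbb{Z}}$ and integers $a\le b$, $\Sigma_a^b(z)=\sum_{a\le i\le b}z_i$; $\Sigma_{b+1}^b(z)=0$; and for $a>b+1$, $\Sigma_a^b(z)=-\Sigma_{b+1}^{a-1}(z)$. For $x\in\{ -1,1\}^{\mathbb{Z}/N\mathbb{Z}}$, its lift is $\tilde x\in\{ -1,1\}^{\mathbb{Z}}$ with $\tilde x_i=x_{i\bmod N}$; $\Sigma(x)=\sum_{i\in\mathbb{Z}/N\mathbb{Z}}x_i$ and $\Sigma_a^b(x)=\Sigma_a^b(\tilde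 x)$. When $\Sigma(x)=0$, the range $r(x)=\sup\{\Sigma_a^b(x):a\le b+1\}=-\inf\{\Sigma_a^b(x):a\le b+1\}$ (finite). The bounding cylinder of a loop $L$ is the smallest set of the form $\{(u,v): m\le u\le M\}$ containing $L$, and its bounding sequence is $y_m,y_{m+1},\ldots,y_M$. A consecutive subsequence $y_m,\ldots,y_M$ of $y$ is positively overflowing if $\Sigma_m^M(y)>r(x)$, and negatively overflowing if $\Sigma_m^M(y)<-r(x)$; it is minimally positively (resp. negatively) overflowing if it is positively (resp. negatively) overflowing and for no indices $m<m'\le M'<M$ is $y_{m'},\ldots,y_{M'}$ positively (resp. negatively) overflowing.
   Formalization: "Minimally overflowing" is taken to mean that no proper consecutive subsequence (m ≤ m' ≤ M' ≤ M, not both equal) overflows; with the strict m < m' ≤ M' < M the converse fails, e.g. N=2, x=(1,-1), y constantly 1, window 1,1,1. -}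

module Defs where

open import Data.Nat as ℕ using (ℕ; zero; suc; NonZero)
open import Data.Integer as ℤ using (ℤ; +_; -[1+_]; _+_; _-_; -_; _*_; _<_; _≤_; 0ℤ; 1ℤ; -1ℤ)
open import Data.Integer.DivMod using (_%ℕ_; n%ℕd<d)
open import Data.Fin using (Fin; toℕ; fromℕ<)
open import Data.List using (List; foldr; map)
open import Data.List.Base using (allFin)
open import Data.Sign using (Sign)
open import Data.Product using (_×_; _,_; proj₁; proj₂; ∃; ∃-syntax)
open import Data.Sum using (_⊎_)
open import Relation.Binary.PropositionalEquality using (_≡_; _≢_)
open import Relation.Nullary using (¬_)

⟦_⟧ : Sign → ℤ
⟦ Sign.+ ⟧ = 1ℤ
⟦ Sign.- ⟧ = -1ℤ

reduce : (N : ℕ) .{{_ : NonZero N}} → ℤ → Fin N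
reduce N k = fromℕ< (n%ℕd<d k N)

lift : (N : ℕ) .{{_ : NonZero N}} → (Fin N → Sign) → ℤ → ℤ
lift N x i = ⟦ x (reduce N i) ⟧

total : (N : ℕ) → (Fin N → Sign) → ℤ
total N x = foldr _+_ 0ℤ (map (λ j → ⟦ x j ⟧) (allFin N))

sumFrom : (ℤ → ℤ) → ℤ → ℕ → ℤ
sumFrom z a zero    = 0ℤ
sumFrom z a (suc n) = z a + sumFrom z (a + 1ℤ) n

-- Σ_a^b(z): if a ≤ b+1 it is ∑_{a ≤ i ≤ b} z_i (0 when a = b+1);
-- if a > b+1 it is -Σ_{b+1}^{a-1}(z).
Sum : (ℤ → ℤ) → ℤ → ℤ → ℤ
Sum z a b with (b + 1ℤ) - a
... | + n      = sumFrom z a n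
... | -[1+ n ] = - sumFrom z (b + 1ℤ) (suc n)

IsRange : (N : ℕ) .{{_ : NonZero N}} → (Fin N → Sign) → ℤ → Set
IsRange N x r =
  (∀ a b → a ≤ b + 1ℤ → Sum (lift N x) a b ≤ r) ×
  (∀ s → (∀ a b → a ≤ b + 1ℤ → Sum (lift N x) a b ≤ s) → r ≤ s)

Vertex : ℕ → Set
Vertex N = ℤ × Fin N

data Kind : Set where
  hor ver : Kind

-- (hor , i , j) is the edge between (i,j) and (i+1,j);
-- (ver , i , j) is the edge between (i,j) and (i,j+1).
Edge : ℕ → Set
Edge N = Kind × ℤ × Fin N

orient : {A : Set} → Sign → A → A → A × A
orient Sign.+ u v = u , v
orient Sign.- u v = v , u

ends : (N : ℕ) .{{_ : NonZero N}} → (Fin N → Sign) → (ℤ → Sign) →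
       Edge N → Vertex N × Vertex N
ends N x y (hor , i , j) = orient (x j) (i , j) (i + 1ℤ , j)
ends N x y (ver , i , j) = orient (y i) (i , j) (i , reduce N (+ toℕ j + 1ℤ))

tail head : (N : ℕ) .{{_ : NonZero N}} → (Fin N → Sign) → (ℤ → Sign) →
            Edge N → Vertex N
tail N x y e = proj₁ (ends N x y e)
head N x y e = proj₂ (ends N x y e)

-- contribution of a (traversed) edge to Δy: +1 for (i,j) → (i,j+1),
-- -1 for (i,j+1) → (i,j), 0 for horizontal edges
up : {N : ℕ} → (ℤ → Sign) → Edge N → ℤ
up y (hor , i , j) = 0ℤ
up y (ver , i , j) = ⟦ y i ⟧

-- A hitomezashi loop: a closed directed circuit (closed walk with no
-- repeated edge) following the orientations and alternating between
-- horizontal and vertical edges.  It is given as the periodic sequence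
-- edge 0, edge 1, ... of its edges, with period len.
record Loop (N : ℕ) .{{_ : NonZero N}} (x : Fin N → Sign) (y : ℤ → Sign) : Set where
  field
    len        : ℕ
    len>0      : 0 ℕ.< len
    edge       : ℕ → Edge N
    periodic   : ∀ k → edge (k ℕ.+ len) ≡ edge k
    follows    : ∀ k → head N x y (edge k) ≡ tail N x y (edge (suc k))
    alternates : ∀ k → proj₁ (edge (suc k)) ≢ proj₁ (edge k)
    noRepeat   : ∀ k k′ → k ℕ.< len → k′ ℕ.< len → edge k ≡ edge k′ → k ≡ k′

open Loop public

sumBelow : ℕ → (ℕ → ℤ) → ℤ
sumBelow zero    f = 0ℤ
sumBelow (suc n) f = sumBelow n f + f n

module _ {N : ℕ} .{{_ : NonZero N}} {x : Fin N → Sign} {y : ℤ → Sign} where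

  Δy : Loop N x y → ℤ
  Δy L = sumBelow (len L) (λ k → up y (edge L k))

  HasHomologyClass : Loop N x y → ℤ → Set
  HasHomologyClass L c = Δy L ≡ c * + N

  OnLoop : Loop N x y → Vertex N → Set
  OnLoop L v = ∃[ k ] (tail N x y (edge L k) ≡ v ⊎ head N x y (edge L k) ≡ v)

  InCylinder : Loop N x y → ℤ → ℤ → Set
  InCylinder L m M = ∀ v → OnLoop L v → m ≤ proj₁ v × proj₁ v ≤ M

  -- {(u,v) : m ≤ u ≤ M} is the bounding cylinder of L (the smallest such
  -- set containing L); equivalently, the bounding sequence of L is y_m,…,y_M
  BoundingCylinder : Loop N x y → ℤ → ℤ → Set
  BoundingCylinder L m M =
    InCylinder L m M × (∀ m′ M′ → InCylinder L m′ M′ → m′ ≤ m × M ≤ M′)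

  -- L and L′ are the same loop (same circuit, up to choice of starting edge)
  SameLoop : Loop N x y → Loop N x y → Set
  SameLoop L L′ = ∃[ s ] (∀ k → edge L′ k ≡ edge L (k ℕ.+ s))

module _ (y : ℤ → Sign) (r : ℤ) where

  ỹ : ℤ → ℤ
  ỹ i = ⟦ y i ⟧

  PosOverflowing NegOverflowing : ℤ → ℤ → Set
  PosOverflowing m M = m ≤ M × r < Sum ỹ m M
  NegOverflowing m M = m ≤ M × Sum ỹ m M < - r

  MinPosOverflowing MinNegOverflowing : ℤ → ℤ → Set
  MinPosOverflowing m M = PosOverflowing m M ×
    (∀ m′ M′ → m ≤ m′ → m′ ≤ M′ → M′ ≤ M → (m′ ≢ m ⊎ M′ ≢ M) →
       ¬ PosOverflowing m′ M′)
  MinNegOverflowing m M = NegOverflowing m M ×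
    (∀ m′ M′ → m ≤ m′ → m′ ≤ M′ → M′ ≤ M → (m′ ≢ m ⊎ M′ ≢ M) →
       ¬ NegOverflowing m′ M′)

{-# OPTIONS --safe #-}
module Submission where

open import Defs
open import Data.Nat as ℕ using (ℕ; zero; suc; NonZero; z≤n; s≤s)
import Data.Nat.Properties as ℕₚ
open import Data.Nat.Tactic.RingSolver using () renaming (solve to ℕ-solve)
open import Data.Integer as ℤ using (ℤ; +_; -[1+_]; _+_; _-_; -_; _*_; _<_; _≤_; 0ℤ; 1ℤ; -1ℤ)
import Data.Integer.Properties as ℤₚ
open import Data.Integer.DivMod using (_%ℕ_; _/ℕ_; n%ℕd<d; a≡a%ℕn+[a/ℕn]*n)
open import Data.Integer.Tactic.RingSolver using (solve)
open import Data.Fin as Fin using (Fin; toℕ)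
import Data.Fin.Properties as Finₚ
open import Data.List using ([]; _∷_; foldr; tabulate)
open import Data.List.Properties using (map-tabulate)
open import Data.Sign using (Sign)
open import Data.Product using (_×_; _,_; proj₁; proj₂; Σ; ∃-syntax)
open import Data.Product.Properties using (≡-dec)
open import Data.Sum using (_⊎_; inj₁; inj₂)
open import Data.Empty using (⊥; ⊥-elim)
open import Function using (_∘_)
open import Relation.Binary.Definitions using (tri<; tri≈; tri>)
open import Relation.Binary.PropositionalEquality using (_≡_; _≢_; refl; sym; trans; cong; cong₂; subst; subst₂; module ≡-Reasoning)
open import Relation.Nullary using (¬_; Dec; yes; no)

-- Let X and Y be the prefix sums of x and y, and give the face with upper
-- right corner (i , j) the value X j − Y i.  Faces sharing an edge differ by
-- one, and the mean of the two values is constant along a hitomezashi path,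
-- so paths are level curves.  A path of level c can pass between columns
-- u − 1 and u only if Y u + c lies strictly between min X and max X, whose
-- difference is r.
--
-- A loop of class 1 crosses every height upwards.  Where it crosses the
-- height of min X, the column to its left is impassable at that level, so
-- this happens in the leftmost column m; likewise max X is attained at the
-- rightmost column M.  Comparing the levels gives Σ_m^M(y) = r + 1, and since
-- the loop does pass between all intermediate columns, no proper
-- subsequence overflows.
--
-- Conversely, the path through column m at the height of min X is confined
-- to the columns m … M, hence closes up.  It returns to that height only
-- through the same edge, always upwards, so it has class 1.  Every loop of
-- class 1 with this cylinder contains that edge, which gives uniqueness.
--
-- For class −1, the same argument applies to σX and σY with σ = −1.

-- Linear arithmetic: hypotheses are turned into nonnegative differences
-- (gap), added up (_⊹_), and the sum is compared with the goal by the ring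
-- solver.

gap : ∀ {a b} → a ≤ b → 0ℤ ≤ b - a
gap = ℤₚ.i≤j⇒0≤j-i

gap< : ∀ {a b} → a < b → 0ℤ ≤ b - (1ℤ + a)
gap< a<b = gap (ℤₚ.i<j⇒suc[i]≤j a<b)

gap≡ : ∀ {a b} → a ≡ b → 0ℤ ≤ b - a
gap≡ e = gap (ℤₚ.≤-reflexive e)

infixl 6 _⊹_
_⊹_ : ∀ {a b} → 0ℤ ≤ a → 0ℤ ≤ b → 0ℤ ≤ a + b
_⊹_ = ℤₚ.+-mono-≤

abstract
  lin≤ : ∀ {a b d} → 0ℤ ≤ d → d ≡ b - a → a ≤ b
  lin≤ p e = ℤₚ.0≤i-j⇒j≤i (subst (0ℤ ≤_) e p)

  lin< : ∀ {a b d} → 0ℤ ≤ d → d ≡ b - (1ℤ + a) → a < b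
  lin< p e = ℤₚ.suc[i]≤j⇒i<j (lin≤ p e)

  lin⊥ : ∀ {d} → 0ℤ ≤ d → d ≡ -1ℤ → ⊥
  lin⊥ p refl with () ← p

  lin≡ : ∀ {a b} → a - b ≡ 0ℤ → a ≡ b
  lin≡ {a} {b} = ℤₚ.i-j≡0⇒i≡j a b

-- Integer arithmetic: halving, parity, intermediate values and minima.

half-≤ : ∀ a b → a + a ≤ b + b + 1ℤ → a ≤ b
half-≤ a b h with a ℤₚ.≤? b
... | yes p = p
... | no ¬p = ⊥-elim (lin⊥ (gap h ⊹ gap< b<a ⊹ gap< b<a) (solve (a ∷ b ∷ [])))
  where b<a = ℤₚ.≰⇒> ¬p

half-≡ : ∀ a b → a + a ≡ b + b → a ≡ b
half-≡ a b e = ℤₚ.≤-antisym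
  (half-≤ a b (lin≤ (gap≡ e ⊹ ℤ.+≤+ (z≤n {1})) (solve (a ∷ b ∷ []))))
  (half-≤ b a (lin≤ (gap≡ (sym e) ⊹ ℤ.+≤+ (z≤n {1})) (solve (a ∷ b ∷ []))))

even≢odd : ∀ a b → a + a ≢ b + b + 1ℤ
even≢odd a b e = lin⊥ (gap a≤b ⊹ gap a≤b ⊹ gap≡ (sym e)) (solve (a ∷ b ∷ []))
  where a≤b = half-≤ a b (ℤₚ.≤-reflexive e)

odd-shift : ∀ j q n → j + j + 1ℤ + q * (n + n) ≡ (j + q * n) + (j + q * n) + 1ℤ
odd-shift j q n = solve (j ∷ q ∷ n ∷ [])

+1-cancel : ∀ a → a + 1ℤ - 1ℤ ≡ a
+1-cancel a = solve (a ∷ [])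

-1-cancel : ∀ a → a - 1ℤ + 1ℤ ≡ a
-1-cancel a = solve (a ∷ [])

<⇒+1≤ : ∀ {a b} → a < b → a + 1ℤ ≤ b
<⇒+1≤ {a} {b} p = lin≤ (gap< p) (solve (a ∷ b ∷ []))

<+1⇒≤ : ∀ {a b} → a < b + 1ℤ → a ≤ b
<+1⇒≤ {a} {b} p = lin≤ (gap< p) (solve (a ∷ b ∷ []))

≤⇒<+1 : ∀ {a b} → a ≤ b → a < b + 1ℤ
≤⇒<+1 {a} {b} p = lin< (gap p) (solve (a ∷ b ∷ []))

i≤i+1 : ∀ i → i ≤ i + 1ℤ
i≤i+1 i = lin≤ (ℤ.+≤+ (z≤n {1})) (solve (i ∷ []))

+1-injective : ∀ a b → a + 1ℤ ≡ b + 1ℤ → a ≡ b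
+1-injective a b e = trans (sym (+1-cancel a)) (trans (cong (_- 1ℤ) e) (+1-cancel b))

-- Going down from `n`, stop at the first `k` with `f k ≤ v`. Its successor value exceeds `v`, and
-- since a step rises by at most one, both values are forced.
discrete-ivt : ∀ (f : ℕ → ℤ) → (∀ k → f (suc k) ≤ f k + 1ℤ) → ∀ v n → f 0 ≤ v → v < f n →
               ∃[ k ] (f k ≡ v × f (suc k) ≡ v + 1ℤ)
discrete-ivt f step v zero    lo hi = ⊥-elim (ℤₚ.<⇒≱ hi lo)
discrete-ivt f step v (suc n) lo hi with v ℤₚ.<? f n
... | yes v<fn = discrete-ivt f step v n lo v<fn
... | no  v≮fn = n , fn≡v , ℤₚ.≤-antisym (subst (λ t → f (suc n) ≤ t + 1ℤ) fn≡v (step n)) (<⇒+1≤ hi)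
  where
  above : ∀ a b c → b < c → c ≤ a + 1ℤ → b ≤ a
  above a b c p q = lin≤ (gap< p ⊹ gap q) (solve (a ∷ b ∷ c ∷ []))
  fn≡v : f n ≡ v
  fn≡v = ℤₚ.≤-antisym (ℤₚ.≮⇒≥ v≮fn) (above (f n) v (f (suc n)) hi (step n))

argmin : ∀ n .{{_ : NonZero n}} (f : Fin n → ℤ) → ∃[ i ] (∀ j → f i ≤ f j)
argmin (suc zero)    f = Fin.zero , λ { Fin.zero → ℤₚ.≤-refl }
argmin (suc (suc n)) f with argmin (suc n) (f ∘ Fin.suc)
... | i , min with f Fin.zero ℤₚ.≤? f (Fin.suc i)
...   | yes p = Fin.zero , λ { Fin.zero → ℤₚ.≤-refl ; (Fin.suc j) → ℤₚ.≤-trans p (min j) }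
...   | no ¬p = Fin.suc i , λ { Fin.zero → ℤₚ.<⇒≤ (ℤₚ.≰⇒> ¬p) ; (Fin.suc j) → min j }

-- Prefix sums

-- This is `Sum z 0ℤ (a - 1ℤ)` with its sign convention, so that the step equation also holds for
-- negative arguments and across 0.
prefix : (ℤ → ℤ) → ℤ → ℤ
prefix z (+ n)      = sumFrom z 0ℤ n
prefix z (-[1+ n ]) = - sumFrom z -[1+ n ] (suc n)

sumFrom-snoc : ∀ z a n → sumFrom z a (suc n) ≡ sumFrom z a n + z (a + + n)
sumFrom-snoc z a zero = begin
  z a + 0ℤ          ≡⟨ ℤₚ.+-comm (z a) 0ℤ ⟩
  0ℤ + z a          ≡⟨ cong (λ t → 0ℤ + z t) (sym (ℤₚ.+-identityʳ a)) ⟩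
  0ℤ + z (a + + 0)  ∎
  where open ≡-Reasoning
sumFrom-snoc z a (suc n) = begin
  z a + sumFrom z (a + 1ℤ) (suc n)                   ≡⟨ cong (λ t → z a + t) (sumFrom-snoc z (a + 1ℤ) n) ⟩
  z a + (sumFrom z (a + 1ℤ) n + z (a + 1ℤ + + n))    ≡⟨ sym (ℤₚ.+-assoc (z a) _ _) ⟩
  z a + sumFrom z (a + 1ℤ) n + z (a + 1ℤ + + n)      ≡⟨ cong (λ t → z a + sumFrom z (a + 1ℤ) n + z t) (ℤₚ.+-assoc a 1ℤ (+ n)) ⟩
  z a + sumFrom z (a + 1ℤ) n + z (a + + suc n)       ∎
  where open ≡-Reasoning

prefix-step : ∀ z a → prefix z (a + 1ℤ) ≡ prefix z a + z a
prefix-step z (+ n) = begin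
  sumFrom z 0ℤ (n ℕ.+ 1)           ≡⟨ cong (sumFrom z 0ℤ) (ℕₚ.+-comm n 1) ⟩
  sumFrom z 0ℤ (suc n)             ≡⟨ sumFrom-snoc z 0ℤ n ⟩
  sumFrom z 0ℤ n + z (0ℤ + + n)    ∎
  where open ≡-Reasoning
prefix-step z (-[1+ zero ]) = cancel (z -1ℤ)
  where
  cancel : ∀ a → 0ℤ ≡ - (a + 0ℤ) + a
  cancel a = solve (a ∷ [])
prefix-step z (-[1+ suc n ]) = cancel (z -[1+ suc n ]) (sumFrom z -[1+ n ] (suc n))
  where
  cancel : ∀ a s → - s ≡ - (a + s) + a
  cancel a s = solve (a ∷ s ∷ [])

sumFrom-prefix : ∀ z a n → sumFrom z a n ≡ prefix z (a + + n) - prefix z a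
sumFrom-prefix z a zero = sym (trans (cong (λ t → prefix z t - prefix z a) (ℤₚ.+-identityʳ a)) (ℤₚ.+-inverseʳ (prefix z a)))
sumFrom-prefix z a (suc n) = begin
  z a + sumFrom z (a + 1ℤ) n                                       ≡⟨ cong (λ t → z a + t) (sumFrom-prefix z (a + 1ℤ) n) ⟩
  z a + (prefix z (a + 1ℤ + + n) - prefix z (a + 1ℤ))              ≡⟨ cong₂ (λ s t → z a + (prefix z s - t)) (ℤₚ.+-assoc a 1ℤ (+ n)) (prefix-step z a) ⟩
  z a + (prefix z (a + + suc n) - (prefix z a + z a))              ≡⟨ cancel (z a) (prefix z (a + + suc n)) (prefix z a) ⟩
  prefix z (a + + suc n) - prefix z a                              ∎
  where
  open ≡-Reasoning
  cancel : ∀ u v w → u + (v - (w + u)) ≡ v - w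
  cancel u v w = solve (u ∷ v ∷ w ∷ [])

-- Removes the case distinction in `Sum`: from here on every sum is a difference of prefix sums,
-- whatever the order of its bounds.
Sum-prefix : ∀ z a b → Sum z a b ≡ prefix z (b + 1ℤ) - prefix z a
Sum-prefix z a b with (b + 1ℤ) - a in eq
... | + n      = trans (sumFrom-prefix z a n) (cong (λ t → prefix z t - prefix z a) (trans (cong (λ t → a + t) (sym eq)) (move a b)))
  where
  move : ∀ a b → a + (b + 1ℤ - a) ≡ b + 1ℤ
  move a b = solve (a ∷ b ∷ [])
... | -[1+ n ] = begin
  - sumFrom z (b + 1ℤ) (suc n)                                     ≡⟨ cong -_ (sumFrom-prefix z (b + 1ℤ) (suc n)) ⟩
  - (prefix z (b + 1ℤ + + suc n) - prefix z (b + 1ℤ))              ≡⟨ cong (λ t → - (prefix z t - prefix z (b + 1ℤ))) end ⟩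
  - (prefix z a - prefix z (b + 1ℤ))                               ≡⟨ flip (prefix z a) (prefix z (b + 1ℤ)) ⟩
  prefix z (b + 1ℤ) - prefix z a                                   ∎
  where
  open ≡-Reasoning
  flip : ∀ u v → - (u - v) ≡ v - u
  flip u v = solve (u ∷ v ∷ [])
  move : ∀ a b → b + 1ℤ + - (b + 1ℤ - a) ≡ a
  move a b = solve (a ∷ b ∷ [])
  end : b + 1ℤ + + suc n ≡ a
  end = trans (cong (λ t → b + 1ℤ + - t) (sym eq)) (move a b)

foldr-tabulate : ∀ (z : ℤ → ℤ) n (f : Fin n → ℤ) a → (∀ i → z (a + + toℕ i) ≡ f i) →
                 foldr _+_ 0ℤ (tabulate f) ≡ sumFrom z a n
foldr-tabulate z zero    f a h = refl
foldr-tabulate z (suc n) f a h = cong₂ _+_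
  (trans (sym (h Fin.zero)) (cong z (ℤₚ.+-identityʳ a)))
  (foldr-tabulate z n (f ∘ Fin.suc) (a + 1ℤ)
    (λ i → trans (cong z (ℤₚ.+-assoc a 1ℤ (+ toℕ i))) (h (Fin.suc i))))

sumBelow-telescope : ∀ (f g : ℕ → ℤ) → (∀ k → g (suc k) ≡ g k + f k) → ∀ n → sumBelow n f ≡ g n - g 0
sumBelow-telescope f g step zero    = sym (ℤₚ.+-inverseʳ (g 0))
sumBelow-telescope f g step (suc n) = begin
  sumBelow n f + f n    ≡⟨ cong (_+ f n) (sumBelow-telescope f g step n) ⟩
  g n - g 0 + f n       ≡⟨ swap (g n) (g 0) (f n) ⟩
  g n + f n - g 0       ≡⟨ cong (_- g 0) (sym (step n)) ⟩
  g (suc n) - g 0       ∎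
  where
  open ≡-Reasoning
  swap : ∀ a b c → a - b + c ≡ a + c - b
  swap a b c = solve (a ∷ b ∷ c ∷ [])

sumBelow-cong : ∀ {f g : ℕ → ℤ} → (∀ k → f k ≡ g k) → ∀ n → sumBelow n f ≡ sumBelow n g
sumBelow-cong h zero    = refl
sumBelow-cong h (suc n) = cong₂ _+_ (sumBelow-cong h n) (h n)

-- Residues

module _ (N : ℕ) .{{nz : NonZero N}} where

  -- A positive `q` would force `N ≤ a`; a negative one is the same situation with `a` and `b`
  -- exchanged.
  residue-unique : ∀ a b q → a ℕ.< N → b ℕ.< N → + a ≡ + b + q * + N → a ≡ b
  residue-unique a b (+ zero)  a<N b<N e =
    ℤₚ.+-injective (trans e (trans (cong (λ t → + b + t) (ℤₚ.*-zeroˡ (+ N))) (ℤₚ.+-identityʳ (+ b))))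
  residue-unique a b (+ suc n) a<N b<N e = ⊥-elim (ℕₚ.<⇒≱ a<N (ℤₚ.drop‿+≤+ N≤a))
    where
    rep : + a ≡ + (b ℕ.+ (N ℕ.+ n ℕ.* N))
    rep = trans e (cong (λ t → + b + t) (sym (ℤₚ.pos-* (suc n) N)))
    N≤a : + N ≤ + a
    N≤a = subst (+ N ≤_) (sym rep) (ℤ.+≤+ (ℕₚ.≤-trans (ℕₚ.m≤m+n N (n ℕ.* N)) (ℕₚ.m≤n+m _ b)))
  residue-unique a b (-[1+ n ]) a<N b<N e =
    sym (residue-unique b a (+ suc n) b<N a<N (trans (move (+ b) -[1+ n ] (+ N)) (cong (λ t → t + - -[1+ n ] * + N) (sym e))))
    where
    move : ∀ b q N → b ≡ b + q * N + (- q) * N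
    move b q N = solve (b ∷ q ∷ N ∷ [])

  toℕ-reduce : ∀ a → toℕ (reduce N a) ≡ a %ℕ N
  toℕ-reduce a = Finₚ.toℕ-fromℕ< (n%ℕd<d a N)

  reduce-decomposition : ∀ a → a ≡ + toℕ (reduce N a) + (a /ℕ N) * + N
  reduce-decomposition a = trans (a≡a%ℕn+[a/ℕn]*n a N) (cong (λ t → + t + (a /ℕ N) * + N) (sym (toℕ-reduce a)))

  reduce-+* : ∀ a q → reduce N (a + q * + N) ≡ reduce N a
  reduce-+* a q = Finₚ.toℕ-injective
    (residue-unique _ _ (q + a /ℕ N - (a + q * + N) /ℕ N) (Finₚ.toℕ<n (reduce N (a + q * + N))) (Finₚ.toℕ<n (reduce N a))
      (combine (+ toℕ (reduce N (a + q * + N))) (+ toℕ (reduce N a)) q (+ N) a ((a + q * + N) /ℕ N) (a /ℕ N)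
        (reduce-decomposition (a + q * + N)) (reduce-decomposition a)))
    where
    combine : ∀ r₁ r₂ q n a d₁ d₂ → a + q * n ≡ r₁ + d₁ * n → a ≡ r₂ + d₂ * n → r₁ ≡ r₂ + (q + d₂ - d₁) * n
    combine r₁ r₂ q n a d₁ d₂ e₁ e₂ = begin
      r₁                                          ≡⟨ solve (r₁ ∷ d₁ ∷ n ∷ []) ⟩
      r₁ + d₁ * n - d₁ * n                        ≡⟨ cong (_- d₁ * n) (sym e₁) ⟩
      a + q * n - d₁ * n                          ≡⟨ cong (λ t → t + q * n - d₁ * n) e₂ ⟩
      r₂ + d₂ * n + q * n - d₁ * n                ≡⟨ solve (r₂ ∷ d₁ ∷ d₂ ∷ q ∷ n ∷ []) ⟩
      r₂ + (q + d₂ - d₁) * n                      ∎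
      where open ≡-Reasoning

  reduce-≡⇒ : ∀ a b → reduce N a ≡ reduce N b → ∃[ q ] a ≡ b + q * + N
  reduce-≡⇒ a b e = a /ℕ N - b /ℕ N ,
    combine (+ toℕ (reduce N a)) (+ N) a b (a /ℕ N) (b /ℕ N) (reduce-decomposition a)
      (trans (reduce-decomposition b) (cong (λ t → + toℕ t + (b /ℕ N) * + N) (sym e)))
    where
    combine : ∀ r n a b d₁ d₂ → a ≡ r + d₁ * n → b ≡ r + d₂ * n → a ≡ b + (d₁ - d₂) * n
    combine r n a b d₁ d₂ e₁ e₂ = begin
      a                               ≡⟨ e₁ ⟩
      r + d₁ * n                      ≡⟨ solve (r ∷ d₁ ∷ d₂ ∷ n ∷ []) ⟩
      r + d₂ * n + (d₁ - d₂) * n      ≡⟨ cong (_+ (d₁ - d₂) * n) (sym e₂) ⟩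
      b + (d₁ - d₂) * n               ∎
      where open ≡-Reasoning

  reduce-toℕ : ∀ j → reduce N (+ toℕ j) ≡ j
  reduce-toℕ j = Finₚ.toℕ-injective
    (residue-unique _ _ (- (+ toℕ j /ℕ N)) (Finₚ.toℕ<n (reduce N (+ toℕ j))) (Finₚ.toℕ<n j)
      (move (+ toℕ (reduce N (+ toℕ j))) (+ toℕ j) (+ toℕ j /ℕ N) (+ N) (reduce-decomposition (+ toℕ j))))
    where
    move : ∀ r a d n → a ≡ r + d * n → r ≡ a + (- d) * n
    move r a d n refl = solve (r ∷ d ∷ n ∷ [])

  reduce-shift : ∀ a b → reduce N (+ toℕ (reduce N a) + b) ≡ reduce N (a + b)
  reduce-shift a b = trans (sym (reduce-+* (+ toℕ (reduce N a) + b) (a /ℕ N))) (cong (reduce N)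
      (combine (+ toℕ (reduce N a)) b a (a /ℕ N) (+ N) (reduce-decomposition a)))
    where
    combine : ∀ r b a d n → a ≡ r + d * n → r + b + d * n ≡ a + b
    combine r b a d n refl = solve (r ∷ b ∷ d ∷ n ∷ [])

  periodic-multiple : (f : ℤ → ℤ) → (∀ a → f (a + + N) ≡ f a) → ∀ a q → f (a + q * + N) ≡ f a
  periodic-multiple f per a (+ n) = up-by n
    where
    shift : ∀ a n → a + (1ℤ + n) * + N ≡ (a + n * + N) + + N
    shift a n = go a n (+ N)
      where
      go : ∀ a n N → a + (1ℤ + n) * N ≡ (a + n * N) + N
      go a n N = solve (a ∷ n ∷ N ∷ [])
    up-by : ∀ n → f (a + + n * + N) ≡ f a
    up-by zero    = cong f (trans (cong (λ t → a + t) (ℤₚ.*-zeroˡ (+ N))) (ℤₚ.+-identityʳ a))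
    up-by (suc n) = trans (cong f (shift a (+ n))) (trans (per _) (up-by n))
  -- Adding the opposite multiple leads back to `a`, and that shift falls under the nonnegative
  -- case.
  periodic-multiple f per a (-[1+ n ]) = begin
    f (a + -[1+ n ] * + N)                       ≡⟨ sym (periodic-multiple f per (a + -[1+ n ] * + N) (+ suc n)) ⟩
    f (a + -[1+ n ] * + N + - -[1+ n ] * + N)    ≡⟨ cong f (cancel a -[1+ n ] (+ N)) ⟩
    f a                                          ∎
    where
    open ≡-Reasoning
    cancel : ∀ a q N → a + q * N + - q * N ≡ a
    cancel a q N = solve (a ∷ q ∷ N ∷ [])

-- Least witnesses and the two kinds of edges.

least : (P : ℕ → Set) → (∀ n → Dec (P n)) → ∀ n → P n → ∃[ p ] (P p × (∀ q → q ℕ.< p → ¬ P q))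
least P P? zero    Pn = 0 , Pn , λ _ ()
least P P? (suc n) Pn with P? 0
... | yes P0 = 0 , P0 , λ _ ()
... | no ¬P0 with least (P ∘ suc) (P? ∘ suc) n Pn
...   | p , Pp , min = suc p , Pp , λ { zero _ → ¬P0 ; (suc q) (s≤s q<p) → min q q<p }

_≟ᴷ_ : (κ κ′ : Kind) → Dec (κ ≡ κ′)
hor ≟ᴷ hor = yes refl
hor ≟ᴷ ver = no λ ()
ver ≟ᴷ hor = no λ ()
ver ≟ᴷ ver = yes refl

-- There are only two kinds. In this form alternation yields that two edges next to edges of the
-- same kind are themselves of the same kind.
kinds-differing : ∀ {κ κ₁ κ₂ : Kind} → κ ≢ κ₁ → κ ≢ κ₂ → κ₁ ≡ κ₂
kinds-differing {hor} {hor}       p q = ⊥-elim (p refl)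
kinds-differing {hor} {ver} {hor} p q = ⊥-elim (q refl)
kinds-differing {hor} {ver} {ver} p q = refl
kinds-differing {ver} {ver}       p q = ⊥-elim (p refl)
kinds-differing {ver} {hor} {ver} p q = ⊥-elim (q refl)
kinds-differing {ver} {hor} {hor} p q = refl

kindIndex : Kind → Fin 2
kindIndex hor = Fin.zero
kindIndex ver = Fin.suc Fin.zero

kindIndex-injective : ∀ κ κ′ → kindIndex κ ≡ kindIndex κ′ → κ ≡ κ′
kindIndex-injective hor hor _ = refl
kindIndex-injective ver ver _ = refl

-- The endpoints of the unit segment [i , i+1] traversed in direction s:
-- it starts at start s i and finishes at finish s i, and the segment
-- starting at i is [back s i , back s i + 1].

start finish back : Sign → ℤ → ℤ
start  Sign.+ i = i
start  Sign.- i = i + 1ℤ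
finish Sign.+ i = i + 1ℤ
finish Sign.- i = i
back   Sign.+ i = i
back   Sign.- i = i - 1ℤ

start-back : ∀ s i → start s (back s i) ≡ i
start-back Sign.+ i = refl
start-back Sign.- i = -1-cancel i

finish-start : ∀ s i → finish s i ≡ start s i + ⟦ s ⟧
finish-start Sign.+ i = refl
finish-start Sign.- i = sym (+1-cancel i)

start-injective : ∀ s i i′ → start s i ≡ start s i′ → i ≡ i′
start-injective Sign.+ i i′ e = e
start-injective Sign.- i i′ e = +1-injective i i′ e

finish-injective : ∀ s i i′ → finish s i ≡ finish s i′ → i ≡ i′
finish-injective Sign.+ i i′ e = +1-injective i i′ e
finish-injective Sign.- i i′ e = e

-- Doubling keeps midpoints integral: the midpoint of a segment lies half a unit from its start in
-- direction `s`.
double-start : ∀ s j → j + j + 1ℤ ≡ start s j + start s j + ⟦ s ⟧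
double-start Sign.+ j = refl
double-start Sign.- j = go j
  where
  go : ∀ j → j + j + 1ℤ ≡ (j + 1ℤ) + (j + 1ℤ) + -1ℤ
  go j = solve (j ∷ [])

double-back : ∀ s j → back s j + back s j + 1ℤ ≡ j + j + ⟦ s ⟧
double-back Sign.+ j = refl
double-back Sign.- j = go j
  where
  go : ∀ j → (j - 1ℤ) + (j - 1ℤ) + 1ℤ ≡ j + j + -1ℤ
  go j = solve (j ∷ [])

double-finish : ∀ s j → finish s j + finish s j ≡ j + j + 1ℤ + ⟦ s ⟧
double-finish Sign.+ j = go j
  where
  go : ∀ j → (j + 1ℤ) + (j + 1ℤ) ≡ j + j + 1ℤ + 1ℤ
  go j = solve (j ∷ [])
double-finish Sign.- j = sym (+1-cancel (j + j))

-- Change of a potential at a turn of the path.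

module _ (Z z : ℤ → ℤ) (step : ∀ a → Z (a + 1ℤ) ≡ Z a + z a) where

  -- The signed term `⟦ s ⟧ * z j` is the change at a turn. Taken once for the rows and once for the
  -- columns, this term and the one in `potential-finish` coincide, which makes the level invariant.
  potential-back : ∀ s j → Z (back s j + 1ℤ) + Z (back s j + 1ℤ) ≡ Z j + Z (j + 1ℤ) + ⟦ s ⟧ * z j
  potential-back Sign.+ j = trans (cong (λ t → t + t) (step j)) (trans (go (Z j) (z j)) (cong (λ t → Z j + t + 1ℤ * z j) (sym (step j))))
    where
    go : ∀ a b → (a + b) + (a + b) ≡ a + (a + b) + 1ℤ * b
    go a b = solve (a ∷ b ∷ [])
  potential-back Sign.- j = trans (cong (λ t → Z t + Z t) (-1-cancel j)) (trans (go (Z j) (z j)) (cong (λ t → Z j + t + -1ℤ * z j) (sym (step j))))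
    where
    go : ∀ a b → a + a ≡ a + (a + b) + -1ℤ * b
    go a b = solve (a ∷ b ∷ [])

  potential-finish : ∀ s i → Z (finish s i) + Z (finish s i + 1ℤ) ≡ Z (i + 1ℤ) + Z (i + 1ℤ) + ⟦ s ⟧ * z (finish s i)
  potential-finish Sign.+ i = trans (cong (λ t → Z (i + 1ℤ) + t) (step (i + 1ℤ))) (go (Z (i + 1ℤ)) (z (i + 1ℤ)))
    where
    go : ∀ a b → a + (a + b) ≡ a + a + 1ℤ * b
    go a b = solve (a ∷ b ∷ [])
  potential-finish Sign.- i = trans (cong (λ t → Z i + t) (step i)) (trans (go (Z i) (z i)) (cong (λ t → t + t + -1ℤ * z i) (sym (step i))))
    where
    go : ∀ a b → a + (a + b) ≡ (a + b) + (a + b) + -1ℤ * b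
    go a b = solve (a ∷ b ∷ [])

-- Hitomezashi paths on the universal cover ℤ × ℤ

LiftedEdge : Set
LiftedEdge = Kind × ℤ × ℤ

module Pattern (N : ℕ) .{{nz : NonZero N}} (x : Fin N → Sign) (y : ℤ → Sign) where

  reduce-start-injective : ∀ s a b → reduce N (start s a) ≡ reduce N (start s b) → reduce N a ≡ reduce N b
  reduce-start-injective Sign.+ a b e = e
  reduce-start-injective Sign.- a b e with reduce-≡⇒ N (a + 1ℤ) (b + 1ℤ) e
  ... | q , a≡ = trans (cong (reduce N) (+1-injective a (b + q * + N) (trans a≡ (move b (q * + N))))) (reduce-+* N b q)
    where
    move : ∀ b c → b + 1ℤ + c ≡ b + c + 1ℤ
    move b c = solve (b ∷ c ∷ [])

  -- `finish` in one direction is `start` in the opposite one.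
  reduce-finish-injective : ∀ s a b → reduce N (finish s a) ≡ reduce N (finish s b) → reduce N a ≡ reduce N b
  reduce-finish-injective Sign.+ = reduce-start-injective Sign.-
  reduce-finish-injective Sign.- = reduce-start-injective Sign.+

  tail-hor : ∀ i j → tail N x y (hor , i , j) ≡ (start (x j) i , j)
  tail-hor i j with x j
  ... | Sign.+ = refl
  ... | Sign.- = refl

  head-hor : ∀ i j → head N x y (hor , i , j) ≡ (finish (x j) i , j)
  head-hor i j with x j
  ... | Sign.+ = refl
  ... | Sign.- = refl

  tail-ver : ∀ i j → tail N x y (ver , i , j) ≡ (i , reduce N (start (y i) (+ toℕ j)))
  tail-ver i j with y i
  ... | Sign.+ = cong (i ,_) (sym (reduce-toℕ N j))
  ... | Sign.- = refl

  head-ver : ∀ i j → head N x y (ver , i , j) ≡ (i , reduce N (finish (y i) (+ toℕ j)))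
  head-ver i j with y i
  ... | Sign.+ = refl
  ... | Sign.- = cong (i ,_) (sym (reduce-toℕ N j))

  -- The tail of a horizontal edge shows its row, hence its orientation, hence the edge; for a
  -- vertical edge the column does the same. So a vertex and a kind determine the outgoing edge.
  tail-injective : ∀ e e′ → proj₁ e ≡ proj₁ e′ → tail N x y e ≡ tail N x y e′ → e ≡ e′
  tail-injective (hor , i , j) (hor , i′ , j′) refl eq
    with e ← trans (sym (tail-hor i j)) (trans eq (tail-hor i′ j′))
    with refl ← cong proj₂ e =
    cong (λ t → hor , t , j) (start-injective (x j) i i′ (cong proj₁ e))
  tail-injective (ver , i , j) (ver , i′ , j′) refl eq
    with e ← trans (sym (tail-ver i j)) (trans eq (tail-ver i′ j′))
    with refl ← cong proj₁ e =
    cong (λ t → ver , i , t) (trans (sym (reduce-toℕ N j)) (trans (reduce-start-injective (y i) _ _ (cong proj₂ e)) (reduce-toℕ N j′)))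

  head-injective : ∀ e e′ → proj₁ e ≡ proj₁ e′ → head N x y e ≡ head N x y e′ → e ≡ e′
  head-injective (hor , i , j) (hor , i′ , j′) refl eq
    with e ← trans (sym (head-hor i j)) (trans eq (head-hor i′ j′))
    with refl ← cong proj₂ e =
    cong (λ t → hor , t , j) (finish-injective (x j) i i′ (cong proj₁ e))
  head-injective (ver , i , j) (ver , i′ , j′) refl eq
    with e ← trans (sym (head-ver i j)) (trans eq (head-ver i′ j′))
    with refl ← cong proj₁ e =
    cong (λ t → ver , i , t) (trans (sym (reduce-toℕ N j)) (trans (reduce-finish-injective (y i) _ _ (cong proj₂ e)) (reduce-toℕ N j′)))

  xs : ℤ → Sign
  xs j = x (reduce N j)

  -- The successor map, its orbits, and heights along them.

  project : LiftedEdge → Edge N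
  project (κ , i , j) = κ , i , reduce N j

  projectᵛ : ℤ × ℤ → Vertex N
  projectᵛ (i , j) = i , reduce N j

  source target : LiftedEdge → ℤ × ℤ
  source (hor , i , j) = start (xs j) i , j
  source (ver , i , j) = i , start (y i) j
  target (hor , i , j) = finish (xs j) i , j
  target (ver , i , j) = i , finish (y i) j

  next : LiftedEdge → LiftedEdge
  next (hor , i , j) = ver , h , back (y h) j
    where h = finish (xs j) i
  next (ver , i , j) = hor , back (xs h) i , h
    where h = finish (y i) j

  reduce-start : ∀ s j → reduce N (start s (+ toℕ (reduce N j))) ≡ reduce N (start s j)
  reduce-start Sign.+ j = reduce-toℕ N (reduce N j)
  reduce-start Sign.- j = reduce-shift N j 1ℤ

  reduce-finish : ∀ s j → reduce N (finish s (+ toℕ (reduce N j))) ≡ reduce N (finish s j)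
  reduce-finish Sign.+ = reduce-start Sign.-
  reduce-finish Sign.- = reduce-start Sign.+

  tail-project : ∀ e → tail N x y (project e) ≡ projectᵛ (source e)
  tail-project (hor , i , j) = tail-hor i (reduce N j)
  tail-project (ver , i , j) = trans (tail-ver i (reduce N j)) (cong (i ,_) (reduce-start (y i) j))

  head-project : ∀ e → head N x y (project e) ≡ projectᵛ (target e)
  head-project (hor , i , j) = head-hor i (reduce N j)
  head-project (ver , i , j) = trans (head-ver i (reduce N j)) (cong (i ,_) (reduce-finish (y i) j))

  source-next : ∀ e → source (next e) ≡ target e
  source-next (hor , i , j) = cong (_ ,_) (start-back (y (finish (xs j) i)) j)
  source-next (ver , i , j) = cong (_, _) (start-back (xs (finish (y i) j)) i)

  project-follows : ∀ e → head N x y (project e) ≡ tail N x y (project (next e))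
  project-follows e = trans (head-project e) (trans (cong projectᵛ (sym (source-next e))) (sym (tail-project (next e))))

  next-alternates : ∀ e → proj₁ (next e) ≢ proj₁ e
  next-alternates (hor , _) ()
  next-alternates (ver , _) ()

  next-unique : ∀ e e′ → head N x y (project e) ≡ tail N x y e′ → proj₁ e′ ≢ proj₁ e → e′ ≡ project (next e)
  next-unique e e′ follow alt = tail-injective e′ (project (next e))
    (kinds-differing (alt ∘ sym) (next-alternates e ∘ sym))
    (trans (sym follow) (project-follows e))

  -- The successor map descends to the cylinder: on the quotient the next edge is already forced by
  -- `next-unique`.
  project-next-cong : ∀ e e′ → project e ≡ project e′ → project (next e) ≡ project (next e′)
  project-next-cong e e′ eq = next-unique e′ (project (next e))
    (trans (cong (head N x y) (sym eq)) (project-follows e))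
    (λ k≡ → next-alternates e (trans k≡ (cong proj₁ (sym eq))))

  orbit : LiftedEdge → ℕ → LiftedEdge
  orbit e zero    = e
  orbit e (suc k) = next (orbit e k)

  column : LiftedEdge → ℤ
  column e = proj₁ (source e)

  column-tail : ∀ e → proj₁ (tail N x y (project e)) ≡ column e
  column-tail e = cong proj₁ (tail-project e)

  column-next : ∀ e → column (next e) ≡ proj₁ (target e)
  column-next e = cong proj₁ (source-next e)

  -- Columns change gradually enough for `discrete-ivt` to apply to them.
  column-step : ∀ e → column (next e) ≤ column e + 1ℤ
  column-step e = subst (_≤ column e + 1ℤ) (sym (column-next e)) (go e)
    where
    go : ∀ e → proj₁ (target e) ≤ column e + 1ℤ
    go (hor , i , j) with xs j
    ... | Sign.+ = ℤₚ.≤-refl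
    ... | Sign.- = ℤₚ.≤-trans (i≤i+1 i) (i≤i+1 (i + 1ℤ))
    go (ver , i , j) = i≤i+1 i

  Straddles : LiftedEdge → ℤ → Set
  Straddles e u = ∃[ i ] ∃[ j ] (e ≡ (hor , i , j) × i + 1ℤ ≡ u)

  straddles-leftward : ∀ e u → u ≤ column e → column (next e) < u → Straddles e u
  straddles-leftward e u p q = go e p (subst (_< u) (column-next e) q)
    where
    go : ∀ e → u ≤ column e → proj₁ (target e) < u → Straddles e u
    go (hor , i , j) p q with xs j
    ... | Sign.+ = ⊥-elim (ℤₚ.<⇒≱ q (ℤₚ.≤-trans p (i≤i+1 i)))
    ... | Sign.- = i , j , refl , ℤₚ.≤-antisym (<⇒+1≤ q) p
    go (ver , i , j) p q = ⊥-elim (ℤₚ.<⇒≱ q p)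

  straddles-rightward : ∀ e u → column e < u → u ≤ column (next e) → Straddles e u
  straddles-rightward e u p q = go e p (subst (u ≤_) (column-next e) q)
    where
    go : ∀ e → column e < u → u ≤ proj₁ (target e) → Straddles e u
    go (hor , i , j) p q with xs j
    ... | Sign.+ = i , j , refl , ℤₚ.≤-antisym (<⇒+1≤ p) q
    ... | Sign.- = ⊥-elim (ℤₚ.<⇒≱ p (ℤₚ.≤-trans q (i≤i+1 i)))
    go (ver , i , j) p q = ⊥-elim (ℤₚ.<⇒≱ p q)

  -- Twice the height of the midpoint of an edge
  midheight : LiftedEdge → ℤ
  midheight (hor , i , j) = j + j
  midheight (ver , i , j) = j + j + 1ℤ

  -- Between the midpoints of consecutive edges the path covers half a vertical edge, in the column
  -- of the vertex where they meet. So the doubled height moves in unit steps.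
  midheight-next : ∀ e → midheight (next e) ≡ midheight e + ⟦ y (column (next e)) ⟧
  midheight-next (hor , i , j) = double-back (y (finish (xs j) i)) j
  midheight-next (ver , i , j) = trans (double-finish (y i) j)
    (cong (λ t → j + j + 1ℤ + ⟦ y t ⟧) (sym (column-next (ver , i , j))))

  midheight-source : ∀ e → midheight e ≡ proj₂ (source e) + proj₂ (source e) + up y (project e)
  midheight-source (hor , i , j) = sym (ℤₚ.+-identityʳ (j + j))
  midheight-source (ver , i , j) = double-start (y i) j

  height-next : ∀ e → proj₂ (source (next e)) ≡ proj₂ (source e) + up y (project e)
  height-next e = trans (cong proj₂ (source-next e)) (go e)
    where
    go : ∀ e → proj₂ (target e) ≡ proj₂ (source e) + up y (project e)
    go (hor , i , j) = sym (ℤₚ.+-identityʳ j)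
    go (ver , i , j) = finish-start (y i) j

  -- The first and last edges agree on the cylinder, so their midpoints are equally far above their
  -- sources, and the heights of the sources telescope.
  midheight-sum : ∀ e n → project (orbit e n) ≡ project e → let s = sumBelow n (λ k → up y (project (orbit e k))) in
                  midheight (orbit e n) ≡ midheight e + (s + s)
  midheight-sum e n closed = go _ (proj₂ (source (orbit e n))) (proj₂ (source e)) _ _ _ _
    (sumBelow-telescope (λ k → up y (project (orbit e k))) (λ k → proj₂ (source (orbit e k))) (λ k → height-next (orbit e k)) n)
    (midheight-source (orbit e n)) (midheight-source e) (cong (up y) closed)
    where
    go : ∀ s hₙ h₀ wₙ w₀ uₙ u₀ → s ≡ hₙ - h₀ → wₙ ≡ hₙ + hₙ + uₙ → w₀ ≡ h₀ + h₀ + u₀ → uₙ ≡ u₀ → wₙ ≡ w₀ + (s + s)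
    go s hₙ h₀ wₙ w₀ uₙ u₀ refl refl refl refl = solve (hₙ ∷ h₀ ∷ uₙ ∷ [])

  -- Loops and their lifts.

  loop-injective : (L L′ : Loop N x y) → ∀ k k′ → edge L (suc k) ≡ edge L′ (suc k′) → edge L k ≡ edge L′ k′
  loop-injective L L′ k k′ e = head-injective _ _
    (kinds-differing (alternates L k) (λ q → alternates L′ k′ (trans (cong proj₁ (sym e)) q)))
    (trans (follows L k) (trans (cong (tail N x y) e) (sym (follows L′ k′))))

  lift-loop : (L : Loop N x y) → ∀ e → project e ≡ edge L 0 → ∀ k → project (orbit e k) ≡ edge L k
  lift-loop L e e₀ zero    = e₀
  lift-loop L e e₀ (suc k) = sym (next-unique (orbit e k) (edge L (suc k))
    (trans (cong (head N x y) (lift-loop L e e₀ k)) (follows L k))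
    (λ q → alternates L k (trans q (cong proj₁ (lift-loop L e e₀ k)))))

  lift-start : (L : Loop N x y) → ∃[ e ] project e ≡ edge L 0
  lift-start L with edge L 0
  ... | κ , i , j = (κ , i , + toℕ j) , cong (λ t → κ , i , t) (reduce-toℕ N j)

  periodic-* : (L : Loop N x y) → ∀ k n → edge L (k ℕ.+ n ℕ.* len L) ≡ edge L k
  periodic-* L k zero    = cong (edge L) (ℕₚ.+-identityʳ k)
  periodic-* L k (suc n) = trans (cong (edge L) (trans (cong (k ℕ.+_) (ℕₚ.+-comm (len L) _)) (sym (ℕₚ.+-assoc k _ (len L)))))
    (trans (periodic L (k ℕ.+ n ℕ.* len L)) (periodic-* L k n))

  -- Allows one to reach position `k` by going forward from any position `n`: with
  -- `d = n * (len L - 1)`, `d + n` steps make `n` full turns.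
  rewind : (L : Loop N x y) → ∀ k n → ∃[ d ] edge L (k ℕ.+ (d ℕ.+ n)) ≡ edge L k
  rewind L k n with len L | len>0 L | periodic-* L k n
  ... | suc l | _ | p = n ℕ.* l , trans (cong (λ t → edge L (k ℕ.+ t)) (move n l)) p
    where
    move : ∀ n l → n ℕ.* l ℕ.+ n ≡ n ℕ.* suc l
    move n l = ℕ-solve (n ∷ l ∷ [])

  -- Paths are deterministic in both directions: go back from the common edge to the start of `L′`,
  -- then forward. Using `rewind` first leaves enough room in `L` to go back `k′` steps.
  common-edge⇒same : (L L′ : Loop N x y) → ∀ k k′ → edge L k ≡ edge L′ k′ → SameLoop L L′
  common-edge⇒same L L′ k k′ eq with rewind L k k′
  ... | d , r = k ℕ.+ d , λ n → forward n (backward k′ (trans (sym eq) (trans (sym r) (cong (edge L) (swap k d k′)))))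
    where
    swap : ∀ k d k′ → k ℕ.+ (d ℕ.+ k′) ≡ k′ ℕ.+ (k ℕ.+ d)
    swap k d k′ = ℕ-solve (k ∷ d ∷ k′ ∷ [])
    backward : ∀ n → edge L′ n ≡ edge L (n ℕ.+ (k ℕ.+ d)) → edge L′ 0 ≡ edge L (k ℕ.+ d)
    backward zero    e = e
    backward (suc n) e = backward n (loop-injective L′ L n (n ℕ.+ (k ℕ.+ d)) e)
    forward : ∀ n → edge L′ 0 ≡ edge L (k ℕ.+ d) → edge L′ n ≡ edge L (n ℕ.+ (k ℕ.+ d))
    forward zero    e = e
    forward (suc n) e = tail-injective _ _
      (kinds-differing (alternates L′ n ∘ sym) (λ q → alternates L (n ℕ.+ (k ℕ.+ d)) (trans (sym q) (cong proj₁ ih))))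
      (trans (sym (follows L′ n)) (trans (cong (head N x y) ih) (follows L _)))
      where ih = forward n e

  -- Closing up of confined paths.

  project-orbit-injective : ∀ e k k′ → project (orbit e (suc k)) ≡ project (orbit e (suc k′)) →
                            project (orbit e k) ≡ project (orbit e k′)
  project-orbit-injective e k k′ eq = head-injective _ _
    (kinds-differing (next-alternates (orbit e k)) (λ q → next-alternates (orbit e k′) (trans (cong proj₁ (sym eq)) q)))
    (trans (project-follows (orbit e k)) (trans (cong (tail N x y) eq) (sym (project-follows (orbit e k′)))))

  -- The successor map is injective along the orbit, so the first `k` steps cancel and a repetition
  -- anywhere is a return to the start.
  orbit-recurs : ∀ e k d → project (orbit e (k ℕ.+ d)) ≡ project (orbit e k) → project (orbit e d) ≡ project e
  orbit-recurs e zero    d eq = eq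
  orbit-recurs e (suc k) d eq = orbit-recurs e k d (project-orbit-injective e (k ℕ.+ d) k eq)

  -- Pigeonhole: kind, column and row of the source determine an edge on the cylinder, and a
  -- confined path has only finitely many such triples.
  orbit-returns : ∀ e m M → (∀ k → m ≤ column (orbit e k) × column (orbit e k) ≤ M) →
                  ∃[ d ] project (orbit e (suc d)) ≡ project e
  orbit-returns e m M bounds = conclude (Finₚ.pigeonhole (ℕₚ.n<1+n _) encode)
    where
    width = suc ℤ.∣ M - m ∣
    offset-abs : ∀ k → + ℤ.∣ column (orbit e k) - m ∣ ≡ column (orbit e k) - m
    offset-abs k = ℤₚ.0≤i⇒+∣i∣≡i (gap (proj₁ (bounds k)))
    offset< : ∀ k → ℤ.∣ column (orbit e k) - m ∣ ℕ.< width
    offset< k = s≤s (ℤₚ.drop‿+≤+ (subst₂ _≤_ (sym (offset-abs k))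
        (sym (ℤₚ.0≤i⇒+∣i∣≡i (gap (ℤₚ.≤-trans (proj₁ (bounds k)) (proj₂ (bounds k))))))
        (ℤₚ.+-monoˡ-≤ (- m) (proj₂ (bounds k)))))
    kind : ℕ → Fin 2
    kind k = kindIndex (proj₁ (orbit e k))
    offset : ℕ → Fin width
    offset k = Fin.fromℕ< (offset< k)
    row : ℕ → Fin N
    row k = reduce N (proj₂ (source (orbit e k)))
    encode : Fin (suc (2 ℕ.* (width ℕ.* N))) → Fin (2 ℕ.* (width ℕ.* N))
    encode k = Fin.combine (kind (toℕ k)) (Fin.combine (offset (toℕ k)) (row (toℕ k)))
    minus-injective : ∀ m a b → a - m ≡ b - m → a ≡ b
    minus-injective m a b eq = lin≡ (trans (regroup m a b) (ℤₚ.i≡j⇒i-j≡0 eq))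
      where
      regroup : ∀ m a b → a - b ≡ (a - m) - (b - m)
      regroup m a b = solve (m ∷ a ∷ b ∷ [])
    column≡ : ∀ a b → offset a ≡ offset b → column (orbit e a) ≡ column (orbit e b)
    column≡ a b eq = minus-injective m _ _ (trans (sym (offset-abs a)) (trans
      (cong +_ (trans (sym (Finₚ.toℕ-fromℕ< (offset< a))) (trans (cong toℕ eq) (Finₚ.toℕ-fromℕ< (offset< b)))))
      (offset-abs b)))
    same-edge : ∀ a b → kind a ≡ kind b → offset a ≡ offset b → row a ≡ row b → project (orbit e a) ≡ project (orbit e b)
    same-edge a b κ≡ o≡ r≡ = tail-injective _ _ (kindIndex-injective _ _ κ≡)
      (trans (tail-project (orbit e a)) (trans (cong₂ _,_ (column≡ a b o≡) r≡) (sym (tail-project (orbit e b)))))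
    conclude : (∃[ a ] ∃[ b ] (a Fin.< b × encode a ≡ encode b)) → ∃[ d ] project (orbit e (suc d)) ≡ project e
    conclude (a , b , a<b , eq) with Finₚ.combine-injective (kind (toℕ a)) _ (kind (toℕ b)) _ eq
    ... | κ≡ , eq′ with Finₚ.combine-injective (offset (toℕ a)) _ (offset (toℕ b)) _ eq′
    ...   | o≡ , r≡ with ℕₚ.m≤n⇒∃[o]m+o≡n a<b
    ...     | d , sum≡ = d , orbit-recurs e (toℕ a) (suc d)
      (trans (cong (λ t → project (orbit e t)) (trans (ℕₚ.+-suc (toℕ a) d) sum≡)) (sym (same-edge (toℕ a) (toℕ b) κ≡ o≡ r≡)))

  orbit-periodic : ∀ e n → project (orbit e n) ≡ project e → ∀ k → project (orbit e (k ℕ.+ n)) ≡ project (orbit e k)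
  orbit-periodic e n closed zero    = closed
  orbit-periodic e n closed (suc k) = project-next-cong _ _ (orbit-periodic e n closed k)

  -- Here `p` is one less than the period, so that the return at time 0 does not count.
  FirstReturn : LiftedEdge → ℕ → Set
  FirstReturn e p = project (orbit e (suc p)) ≡ project e × (∀ q → q ℕ.< p → project (orbit e (suc q)) ≢ project e)

  first-return : ∀ e m M → (∀ k → m ≤ column (orbit e k) × column (orbit e k) ≤ M) → ∃[ p ] FirstReturn e p
  first-return e m M bounds = least (λ d → project (orbit e (suc d)) ≡ project e)
    (λ d → ≡-dec _≟ᴷ_ (≡-dec ℤₚ._≟_ Finₚ._≟_) (project (orbit e (suc d))) (project e))
    (proj₁ returns) (proj₂ returns)
    where returns = orbit-returns e m M bounds

  orbit-loop : ∀ e p → FirstReturn e p → Loop N x y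
  orbit-loop e p (closes , first) = L
    where
    -- A repetition at `k < k′` would already give a return after `k′ - k` steps, earlier than the
    -- first one.
    distinct : ∀ k k′ → k ℕ.< k′ → k′ ℕ.< suc p → project (orbit e k) ≢ project (orbit e k′)
    distinct k k′ k<k′ k′<p eq with ℕₚ.m≤n⇒∃[o]m+o≡n k<k′
    ... | d , refl = first d (ℕₚ.≤-<-trans (ℕₚ.m≤n+m d k) (ℕₚ.≤-pred k′<p))
      (orbit-recurs e k (suc d) (trans (cong (λ t → project (orbit e t)) (ℕₚ.+-suc k d)) (sym eq)))
    separate : ∀ k k′ → k ℕ.< suc p → k′ ℕ.< suc p → project (orbit e k) ≡ project (orbit e k′) → k ≡ k′
    separate k k′ k<p k′<p eq with ℕₚ.<-cmp k k′
    ... | tri< k<k′ _ _ = ⊥-elim (distinct k k′ k<k′ k′<p eq)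
    ... | tri≈ _ k≡k′ _ = k≡k′
    ... | tri> _ _ k′<k = ⊥-elim (distinct k′ k k′<k k<p (sym eq))
    L : Loop N x y
    L = record
      { len = suc p
      ; len>0 = s≤s z≤n
      ; edge = λ k → project (orbit e k)
      ; periodic = orbit-periodic e (suc p) closes
      ; follows = λ k → project-follows (orbit e k)
      ; alternates = λ k → next-alternates (orbit e k)
      ; noRepeat = separate
      }

nonZero-double : ∀ N .{{_ : NonZero N}} → NonZero (N ℕ.+ N)
nonZero-double (suc n) = _

-- For `t ≤ 0` the multiple is below 1, and for `t ≥ 2` it is above `d`. This will determine the
-- height gained at the first return.
unit-multiple : ∀ t d → 1ℤ ≤ + d → 1ℤ ≤ t * + d → t * + d ≤ + d → t * + d ≡ + d
unit-multiple t d 1≤d 1≤td td≤d with t ℤₚ.≤? 0ℤ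
... | yes t≤0 = ⊥-elim (lin⊥ (gap 1≤td ⊹ gap (ℤₚ.*-monoʳ-≤-nonNeg (+ d) t≤0)) (close (t * + d) (+ d)))
  where
  close : ∀ a b → a - 1ℤ + (0ℤ * b - a) ≡ -1ℤ
  close a b = solve (a ∷ b ∷ [])
... | no t≰0 with (+ 2) ℤₚ.≤? t
...   | yes 2≤t = ⊥-elim (lin⊥ (gap td≤d ⊹ gap (ℤₚ.*-monoʳ-≤-nonNeg (+ d) 2≤t) ⊹ gap 1≤d) (close (t * + d) (+ d)))
  where
  close : ∀ a b → b - a + (a - + 2 * b) + (b - 1ℤ) ≡ -1ℤ
  close a b = solve (a ∷ b ∷ [])
...   | no 2≰t = trans (cong (_* + d) t≡1) (ℤₚ.*-identityˡ (+ d))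
  where
  below : ∀ t → t < + 2 → t ≤ 1ℤ
  below t p = lin≤ (gap< p) (solve (t ∷ []))
  t≡1 : t ≡ 1ℤ
  t≡1 = ℤₚ.≤-antisym (below t (ℤₚ.≰⇒> 2≰t)) (ℤₚ.i<j⇒suc[i]≤j (ℤₚ.≰⇒> t≰0))

⟦⟧-square : ∀ σ → ⟦ σ ⟧ * ⟦ σ ⟧ ≡ 1ℤ
⟦⟧-square Sign.+ = refl
⟦⟧-square Sign.- = refl

⟦⟧-product : ∀ σ τ → ⟦ σ ⟧ * ⟦ τ ⟧ ≡ 1ℤ ⊎ ⟦ σ ⟧ * ⟦ τ ⟧ ≡ -1ℤ
⟦⟧-product Sign.+ Sign.+ = inj₁ refl
⟦⟧-product Sign.+ Sign.- = inj₂ refl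
⟦⟧-product Sign.- Sign.+ = inj₂ refl
⟦⟧-product Sign.- Sign.- = inj₁ refl

⟦⟧-cancel : ∀ σ a → ⟦ σ ⟧ * (⟦ σ ⟧ * a) ≡ a
⟦⟧-cancel σ a = trans (sym (ℤₚ.*-assoc ⟦ σ ⟧ ⟦ σ ⟧ a)) (trans (cong (_* a) (⟦⟧-square σ)) (ℤₚ.*-identityˡ a))

module _ {N : ℕ} .{{nz : NonZero N}} {x : Fin N → Sign} {y : ℤ → Sign} where

  -- Tails suffice, because the head of each edge is the tail of the next.
  inCylinder : ∀ (L : Loop N x y) m M →
               (∀ k → m ≤ proj₁ (tail N x y (edge L k)) × proj₁ (tail N x y (edge L k)) ≤ M) → InCylinder L m M
  inCylinder L m M bounds v (k , inj₁ eq) = subst (λ t → m ≤ proj₁ t × proj₁ t ≤ M) eq (bounds k)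
  inCylinder L m M bounds v (k , inj₂ eq) = subst (λ t → m ≤ proj₁ t × proj₁ t ≤ M) (trans (sym (follows L k)) eq) (bounds (suc k))

  boundingCylinder-unique : ∀ (L : Loop N x y) {m M m′ M′} → BoundingCylinder L m M → BoundingCylinder L m′ M′ → m ≡ m′ × M ≡ M′
  boundingCylinder-unique L (in₁ , least₁) (in₂ , least₂) =
    ℤₚ.≤-antisym (proj₁ (least₂ _ _ in₁)) (proj₁ (least₁ _ _ in₂)) ,
    ℤₚ.≤-antisym (proj₂ (least₁ _ _ in₂)) (proj₂ (least₂ _ _ in₁))

-- Periodicity of the prefix sums of `x` and the meaning of the range.

module Potential (N : ℕ) .{{nz : NonZero N}} (x : Fin N → Sign) (balanced : total N x ≡ 0ℤ) where

  P : ℤ → ℤ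
  P = prefix (lift N x)

  P-total : P (+ N) ≡ 0ℤ
  P-total = trans (sym (trans (cong (foldr _+_ 0ℤ) (map-tabulate (λ j → j) (λ j → ⟦ x j ⟧)))
    (foldr-tabulate (lift N x) N (λ j → ⟦ x j ⟧) 0ℤ (λ j → cong (λ t → ⟦ x t ⟧) (trans (cong (reduce N) (ℤₚ.+-identityˡ (+ toℕ j))) (reduce-toℕ N j))))))
    balanced

  reduce-+N : ∀ a → reduce N (a + + N) ≡ reduce N a
  reduce-+N a = trans (cong (λ t → reduce N (a + t)) (sym (ℤₚ.*-identityˡ (+ N)))) (reduce-+* N a 1ℤ)

  -- The increment over one period does not depend on `a`, because both ends step by the same sign;
  -- at 0 it is the total, which vanishes.
  P-periodic : ∀ a → P (a + + N) ≡ P a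
  P-periodic a = lin≡ (trans (constant a) (cong (λ t → t - 0ℤ) (trans (cong P (ℤₚ.+-identityˡ (+ N))) P-total)))
    where
    D : ℤ → ℤ
    D a = P (a + + N) - P a
    swap : ∀ a n → a + 1ℤ + n ≡ a + n + 1ℤ
    swap a n = solve (a ∷ n ∷ [])
    cancel : ∀ p q z → (p + z) - (q + z) ≡ p - q
    cancel p q z = solve (p ∷ q ∷ z ∷ [])
    D-step : ∀ a → D (a + + 1) ≡ D a
    D-step a = trans (cong₂ _-_
      (trans (cong P (swap a (+ N))) (trans (prefix-step (lift N x) (a + + N)) (cong (λ t → P (a + + N) + ⟦ x t ⟧) (reduce-+N a))))
      (prefix-step (lift N x) a)) (cancel (P (a + + N)) (P a) (lift N x a))
    unit : ∀ a → a ≡ 0ℤ + a * 1ℤ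
    unit a = solve (a ∷ [])
    constant : ∀ a → D a ≡ D 0ℤ
    -- Constancy is periodicity with period 1, evaluated at the multiple `a` of 1.
    constant a = trans (cong D (unit a)) (periodic-multiple 1 D D-step 0ℤ a)

  P-reduce : ∀ a b → reduce N a ≡ reduce N b → P a ≡ P b
  P-reduce a b eq with reduce-≡⇒ N a b eq
  ... | q , refl = periodic-multiple N P P-periodic b q

  -- The range only bounds sums with ordered ends, so `u` is first moved to the right of `v` by
  -- `∣ v - u ∣` periods, which leaves `P u` unchanged.
  range-bounds : ∀ r → IsRange N x r → ∀ u v → P u - P v ≤ r
  range-bounds r (bound , _) u v = subst (_≤ r) sum≡ (bound v (u′ - 1ℤ) (subst (v ≤_) (sym (-1-cancel u′)) v≤u′))
    where
    n = ℤ.∣ v - u ∣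
    u′ = u + + n * + N
    sum≡ : Sum (lift N x) v (u′ - 1ℤ) ≡ P u - P v
    sum≡ = trans (Sum-prefix (lift N x) v (u′ - 1ℤ))
      (cong (_- P v) (trans (cong P (-1-cancel u′)) (periodic-multiple N P P-periodic u (+ n))))
    n≤nN : + n ≤ + n * + N
    n≤nN = subst (+ n ≤_) (ℤₚ.pos-* n N) (ℤ.+≤+ (ℕₚ.m≤m*n n N))
    i≤∣i∣ : ∀ i → i ≤ + ℤ.∣ i ∣
    i≤∣i∣ (+ n)      = ℤₚ.≤-refl
    i≤∣i∣ (-[1+ n ]) = ℤ.-≤+
    chain : ∀ u v a b → v - u ≤ a → a ≤ b → v ≤ u + b
    chain u v a b p q = lin≤ (gap p ⊹ gap q) (solve (u ∷ v ∷ a ∷ b ∷ []))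
    v≤u′ : v ≤ u′
    v≤u′ = chain u v (+ n) (+ n * + N) (i≤∣i∣ (v - u)) n≤nN

  range-least : ∀ r → IsRange N x r → ∀ d → (∀ u v → P u - P v ≤ d) → r ≤ d
  range-least r (_ , least) d bound = least d (λ a b _ → subst (_≤ d) (sym (Sum-prefix (lift N x) a b)) (bound (b + 1ℤ) a))

-- The total rise is exactly `r + 1`, so losing at least one unit at the left end leaves at most
-- `r`.
shrunk-left : ∀ r a b a′ b′ → b ≡ a + r + 1ℤ → a + 1ℤ ≤ a′ → b′ ≤ b → r < b′ - a′ → ⊥
shrunk-left r a b a′ b′ e p q o = lin⊥ (gap≡ e ⊹ gap p ⊹ gap q ⊹ gap< o) (solve (r ∷ a ∷ b ∷ a′ ∷ b′ ∷ []))

shrunk-right : ∀ r a b a′ b′ → b ≡ a + r + 1ℤ → a ≤ a′ → b′ + 1ℤ ≤ b → r < b′ - a′ → ⊥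
shrunk-right r a b a′ b′ e p q o = lin⊥ (gap≡ e ⊹ gap p ⊹ gap q ⊹ gap< o) (solve (r ∷ a ∷ b ∷ a′ ∷ b′ ∷ []))

-- `MinPosOverflowing` and `MinNegOverflowing` unfold to instances of this, which lets both signs
-- share one argument.
Minimal : (ℤ → ℤ → Set) → ℤ → ℤ → Set
Minimal O m M = O m M ×
  (∀ m′ M′ → m ≤ m′ → m′ ≤ M′ → M′ ≤ M → (m′ ≢ m ⊎ M′ ≢ M) → ¬ O m′ M′)

-- Levels and barriers for a homology class of sign `σ`.

module Core (N : ℕ) .{{nz : NonZero N}} (x : Fin N → Sign) (y : ℤ → Sign) (balanced : total N x ≡ 0ℤ)
            (r : ℤ) (range : IsRange N x r) (σ : Sign) where

  open Pattern N x y
  open Potential N x balanced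

  s : ℤ
  s = ⟦ σ ⟧

  Q dx dy X Y : ℤ → ℤ
  Q = prefix (λ k → ⟦ y k ⟧)
  dx j = s * ⟦ xs j ⟧
  dy i = s * ⟦ y i ⟧
  X j = s * P j
  Y i = s * Q i

  X-step : ∀ j → X (j + 1ℤ) ≡ X j + dx j
  X-step j = trans (cong (s *_) (prefix-step (lift N x) j)) (ℤₚ.*-distribˡ-+ s (P j) ⟦ xs j ⟧)

  Y-step : ∀ i → Y (i + 1ℤ) ≡ Y i + dy i
  Y-step i = trans (cong (s *_) (prefix-step (λ k → ⟦ y k ⟧) i)) (ℤₚ.*-distribˡ-+ s (Q i) ⟦ y i ⟧)

  X-reduce : ∀ a b → reduce N a ≡ reduce N b → X a ≡ X b
  X-reduce a b eq = cong (s *_) (P-reduce a b eq)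

  X-representative : ∀ j → X (+ toℕ (reduce N j)) ≡ X j
  X-representative j = X-reduce (+ toℕ (reduce N j)) j (reduce-toℕ N (reduce N j))

  abstract
    -- The extremum is placed at `j + 1ℤ` because both faces beside a vertical edge of row `j` have
    -- the `X`-value `X (j + 1ℤ)`; so `jlo` is a row of edges.
    minimum : ∃[ j ] (∀ k → X (j + 1ℤ) ≤ X k)
    minimum with argmin N (λ j → X (+ toℕ j))
    ... | i , min = + toℕ i - 1ℤ , λ k →
      subst₂ _≤_ (cong X (sym (-1-cancel (+ toℕ i)))) (X-representative k) (min (reduce N k))

    maximum : ∃[ j ] (∀ k → X k ≤ X (j + 1ℤ))
    maximum with argmin N (λ j → - X (+ toℕ j))
    ... | i , max = + toℕ i - 1ℤ , λ k →
      subst₂ _≤_ (X-representative k) (cong X (sym (-1-cancel (+ toℕ i)))) (ℤₚ.neg-cancel-≤ (max (reduce N k)))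

  jlo jhi lo hi : ℤ
  jlo = proj₁ minimum
  jhi = proj₁ maximum
  lo = X (jlo + 1ℤ)
  hi = X (jhi + 1ℤ)

  dy≤1 : ∀ i → dy i ≤ 1ℤ
  dy≤1 i with ⟦⟧-product σ (y i)
  ... | inj₁ eq = ℤₚ.≤-reflexive eq
  ... | inj₂ eq = subst (_≤ 1ℤ) (sym eq) ℤ.-≤+

  reduce-suc : ∀ a b → reduce N a ≡ reduce N b → reduce N (a + 1ℤ) ≡ reduce N (b + 1ℤ)
  reduce-suc a b eq = trans (sym (reduce-shift N a 1ℤ)) (trans (cong (λ t → reduce N (+ toℕ t + 1ℤ)) eq) (reduce-shift N b 1ℤ))

  lo≤X : ∀ j → lo ≤ X j
  lo≤X = proj₂ minimum

  X≤hi : ∀ j → X j ≤ hi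
  X≤hi = proj₂ maximum

  -- The differences of `X` are those of `P`, with the two arguments exchanged when `σ` is negative,
  -- so both families have supremum `r`.
  hi-lo : hi ≡ lo + r
  hi-lo = ℤₚ.≤-antisym (above hi lo r (X-diff σ refl (jhi + 1ℤ) (jlo + 1ℤ))) (below hi lo r (range-least r range (hi - lo) P-diff))
    where
    above : ∀ h l r → h - l ≤ r → h ≤ l + r
    above h l r p = lin≤ (gap p) (solve (h ∷ l ∷ r ∷ []))
    below : ∀ h l r → r ≤ h - l → l + r ≤ h
    below h l r p = lin≤ (gap p) (solve (h ∷ l ∷ r ∷ []))
    pos : ∀ a b → 1ℤ * a - 1ℤ * b ≡ a - b
    pos a b = solve (a ∷ b ∷ [])
    neg : ∀ a b → -1ℤ * a - -1ℤ * b ≡ b - a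
    neg a b = solve (a ∷ b ∷ [])
    X-diff : ∀ τ → τ ≡ σ → ∀ u v → X u - X v ≤ r
    X-diff Sign.+ refl u v = subst (_≤ r) (sym (pos (P u) (P v))) (range-bounds r range u v)
    X-diff Sign.- refl u v = subst (_≤ r) (sym (neg (P u) (P v))) (range-bounds r range v u)
    X-spread : ∀ u v → X u - X v ≤ hi - lo
    X-spread u v = ℤₚ.+-mono-≤ (X≤hi u) (ℤₚ.neg-mono-≤ (lo≤X v))
    P-diff : ∀ u v → P u - P v ≤ hi - lo
    P-diff u v = go σ refl
      where
      go : ∀ τ → τ ≡ σ → P u - P v ≤ hi - lo
      go Sign.+ refl = subst (_≤ hi - lo) (pos (P u) (P v)) (X-spread u v)
      go Sign.- refl = subst (_≤ hi - lo) (neg (P v) (P u)) (X-spread v u)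

  0≤r : 0ℤ ≤ r
  0≤r = go lo hi r (lo≤X (jhi + 1ℤ)) hi-lo
    where
    go : ∀ l h r → l ≤ h → h ≡ l + r → 0ℤ ≤ r
    go l h r p q = lin≤ (gap p ⊹ gap≡ q) (solve (l ∷ h ∷ r ∷ []))

  -- Neighbouring values differ by one, so they cannot both be minimal.
  adjacent-lo : ∀ j → lo + lo + 1ℤ ≤ X j + X (j + 1ℤ)
  adjacent-lo j = go lo (X j) (X (j + 1ℤ)) (dx j) (lo≤X j) (lo≤X (j + 1ℤ)) (X-step j) (⟦⟧-product σ (xs j))
    where
    go : ∀ l a b d → l ≤ a → l ≤ b → b ≡ a + d → d ≡ 1ℤ ⊎ d ≡ -1ℤ → l + l + 1ℤ ≤ a + b
    go l a b d p q refl (inj₁ refl) = lin≤ (gap p ⊹ gap p) (solve (l ∷ a ∷ []))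
    go l a b d p q refl (inj₂ refl) = lin≤ (gap q ⊹ gap q) (solve (l ∷ a ∷ []))

  adjacent-hi : ∀ j → X j + X (j + 1ℤ) + 1ℤ ≤ hi + hi
  adjacent-hi j = go hi (X j) (X (j + 1ℤ)) (dx j) (X≤hi j) (X≤hi (j + 1ℤ)) (X-step j) (⟦⟧-product σ (xs j))
    where
    go : ∀ h a b d → a ≤ h → b ≤ h → b ≡ a + d → d ≡ 1ℤ ⊎ d ≡ -1ℤ → a + b + 1ℤ ≤ h + h
    go h a b d p q refl (inj₁ refl) = lin≤ (gap q ⊹ gap q) (solve (h ∷ a ∷ []))
    go h a b d p q refl (inj₂ refl) = lin≤ (gap p ⊹ gap p) (solve (h ∷ a ∷ []))

  -- The sum of X − Y over the two faces adjacent to an edge, where the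
  -- face whose upper right corner is the vertex (i , j) has value X j − Y i.
  level : LiftedEdge → ℤ
  level (hor , i , j) = X j + X (j + 1ℤ) - (Y (i + 1ℤ) + Y (i + 1ℤ))
  level (ver , i , j) = X (j + 1ℤ) + X (j + 1ℤ) - (Y i + Y (i + 1ℤ))

  -- At a turn the `X`-part and the `Y`-part change by the same amount, `s` times the product of the
  -- row sign and the column sign at the vertex.
  level-next : ∀ e → level (next e) ≡ level e
  level-next (hor , i , j) = trans
    (cong₂ _-_ (potential-back X dx X-step (y h) j) (potential-finish Y dy Y-step (xs j) i))
    (cancel (X j + X (j + 1ℤ)) (Y (i + 1ℤ) + Y (i + 1ℤ)) ⟦ y h ⟧ s ⟦ xs j ⟧)
    where
    h = finish (xs j) i
    cancel : ∀ a b p s q → a + p * (s * q) - (b + q * (s * p)) ≡ a - b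
    cancel a b p s q = solve (a ∷ b ∷ p ∷ s ∷ q ∷ [])
  level-next (ver , i , j) = trans
    (cong₂ _-_ (potential-finish X dx X-step (y i) j) (potential-back Y dy Y-step (xs h) i))
    (cancel (X (j + 1ℤ) + X (j + 1ℤ)) (Y i + Y (i + 1ℤ)) ⟦ y i ⟧ s ⟦ xs h ⟧)
    where
    h = finish (y i) j
    cancel : ∀ a b p s q → a + p * (s * q) - (b + q * (s * p)) ≡ a - b
    cancel a b p s q = solve (a ∷ b ∷ p ∷ s ∷ q ∷ [])

  level-orbit : ∀ e k → level (orbit e k) ≡ level e
  level-orbit e zero    = refl
  level-orbit e (suc k) = trans (level-next (orbit e k)) (level-orbit e k)

  -- No edge of level c joins the columns u − 1 and u.
  Barrier : ℤ → ℤ → Set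
  Barrier c u = ∀ j → X j + X (j + 1ℤ) - (Y u + Y u) ≢ c

  straddling-level : ∀ {e u} → Straddles e u → ∃[ j ] X j + X (j + 1ℤ) - (Y u + Y u) ≡ level e
  straddling-level (i , j , refl , refl) = j , refl

  -- A path changes sides only along a straddling edge, and that edge would carry the conserved
  -- level of the path.
  barrier-left : ∀ e u → Barrier (level e) u → u ≤ column e → ∀ n → u ≤ column (orbit e n)
  barrier-left e u barrier p zero    = p
  barrier-left e u barrier p (suc n) with u ℤₚ.≤? column (orbit e (suc n))
  ... | yes q = q
  ... | no ¬q with straddling-level (straddles-leftward (orbit e n) u (barrier-left e u barrier p n) (ℤₚ.≰⇒> ¬q))
  ...   | j , eq = ⊥-elim (barrier j (trans eq (level-orbit e n)))

  barrier-right : ∀ e u → Barrier (level e) u → column e < u → ∀ n → column (orbit e n) < u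
  barrier-right e u barrier p zero    = p
  barrier-right e u barrier p (suc n) with column (orbit e (suc n)) ℤₚ.<? u
  ... | yes q = q
  ... | no ¬q with straddling-level (straddles-rightward (orbit e n) u (barrier-right e u barrier p n) (ℤₚ.≮⇒≥ ¬q))
  ...   | j , eq = ⊥-elim (barrier j (trans eq (level-orbit e n)))

  -- This is the level of a vertical edge at the height of the minimum in a column `u` with
  -- `dy u = 1`. By `adjacent-lo`, an edge straddling `u` has a larger level.
  low-barrier : ∀ u → Barrier (lo + lo - (Y u + (Y u + 1ℤ))) u
  low-barrier u j eq = go lo (X j) (X (j + 1ℤ)) (Y u) (adjacent-lo j) eq
    where
    go : ∀ l a b u → l + l + 1ℤ ≤ a + b → a + b - (u + u) ≡ l + l - (u + (u + 1ℤ)) → ⊥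
    go l a b u p q = lin⊥ (gap p ⊹ gap≡ q ⊹ (ℤ.+≤+ (z≤n {1}))) (solve (l ∷ a ∷ b ∷ u ∷ []))

  -- Mirror image: the level of a vertical edge at the height of the maximum in column `u - 1`, when
  -- that column rises.
  high-barrier : ∀ u → Barrier (hi + hi + 1ℤ - (Y u + Y u)) u
  high-barrier u j eq = go hi (X j) (X (j + 1ℤ)) (Y u) (adjacent-hi j) eq
    where
    go : ∀ h a b u → a + b + 1ℤ ≤ h + h → a + b - (u + u) ≡ h + h + 1ℤ - (u + u) → ⊥
    go h a b u p q = lin⊥ (gap p ⊹ gap≡ (sym q) ⊹ (ℤ.+≤+ (z≤n {1}))) (solve (h ∷ a ∷ b ∷ u ∷ []))

  Overflow MinOverflow : ℤ → ℤ → Set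
  Overflow m M = m ≤ M × r < Y (M + 1ℤ) - Y m
  MinOverflow = Minimal Overflow

  orbit-+ : ∀ e k n → orbit e (k ℕ.+ n) ≡ orbit (orbit e n) k
  orbit-+ e zero    n = refl
  orbit-+ e (suc k) n = cong next (orbit-+ e k n)

  -- From a loop to a minimal overflow.

  module OfLoop (L : Loop N x y) (class : HasHomologyClass L s) where

    e₀ : LiftedEdge
    e₀ = proj₁ (lift-start L)

    lifts : ∀ k → project (orbit e₀ k) ≡ edge L k
    lifts = lift-loop L e₀ (proj₂ (lift-start L))

    w : ℕ → ℤ
    w k = s * midheight (orbit e₀ k)

    w-step : ∀ k → w (suc k) ≡ w k + dy (column (orbit e₀ (suc k)))
    w-step k = trans (cong (s *_) (midheight-next (orbit e₀ k))) (ℤₚ.*-distribˡ-+ s (midheight (orbit e₀ k)) ⟦ y (column (orbit e₀ (suc k))) ⟧)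

    -- The class gives a height gain of `s * N` per turn; doubling it and using `s * s = 1` gives
    -- `2 N`.
    w-turn : w (len L) ≡ w 0 + (+ N + + N)
    w-turn = trans (cong (s *_) (midheight-sum e₀ (len L) (trans (lifts (len L)) (trans (periodic L 0) (sym (lifts 0))))))
      (trans (cong (λ t → s * (midheight e₀ + (t + t)))
               (trans (sumBelow-cong (λ k → cong (up y) (lifts k)) (len L)) class))
        (trans (expand s (midheight e₀) (+ N)) (cong (λ t → s * midheight e₀ + (t + t)) (⟦⟧-cancel σ (+ N)))))
      where
      expand : ∀ s h n → s * (h + (s * n + s * n)) ≡ s * h + (s * (s * n) + s * (s * n))
      expand s h n = solve (s ∷ h ∷ n ∷ [])

    -- The row is prescribed only modulo `N`, since the chosen lift may meet a different translate
    -- of the height `j`.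
    record Crossing (j : ℤ) : Set where
      field
        step    : ℕ
        col row : ℤ
        at      : orbit e₀ step ≡ (ver , col , row)
        residue : reduce N row ≡ reduce N j
        rising  : dy col ≡ 1ℤ

    -- In one turn the loop climbs by N in direction σ, hence crosses every
    -- height in that direction.
    crossing : ∀ j → Crossing j
    crossing j = conclude (discrete-ivt w (λ k → subst (_≤ w k + 1ℤ) (sym (w-step k)) (ℤₚ.+-monoʳ-≤ (w k) (dy≤1 (column (orbit e₀ (suc k)))))) v (len L)
        (subst (_≤ v) (ℤₚ.+-identityʳ (w 0)) (ℤₚ.+-monoʳ-≤ (w 0) (ℤ.+≤+ (z≤n {ρ}))))
        (subst (v <_) (sym w-turn) (ℤₚ.+-monoʳ-< (w 0) (ℤ.+<+ (n%ℕd<d a (N ℕ.+ N) {{nonZero-double N}})))))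
      where
      -- `v` is the representative, between `w 0` and `w 0 + 2 N`, of the signed doubled midheight
      -- of row `j`; `j₀` is the translate of `j` at that height.
      a = s * (j + j + 1ℤ) - w 0
      ρ = _%ℕ_ a (N ℕ.+ N) {{nonZero-double N}}
      q = _/ℕ_ a (N ℕ.+ N) {{nonZero-double N}}
      v = w 0 + + ρ
      j₀ = j + (- (s * q)) * + N
      at : ∀ h → s * h ≡ v → h ≡ j₀ + j₀ + 1ℤ
      at h sh≡v = trans (sym (⟦⟧-cancel σ h)) (trans (cong (s *_) sh≡v)
          (go s (+ ρ) q j (+ N) (w 0) (⟦⟧-square σ) (a≡a%ℕn+[a/ℕn]*n a (N ℕ.+ N) {{nonZero-double N}})))
        where
        go : ∀ s ρ q j n w → s * s ≡ 1ℤ → s * (j + j + 1ℤ) - w ≡ ρ + q * (n + n) →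
             s * (w + ρ) ≡ (j + (- (s * q)) * n) + (j + (- (s * q)) * n) + 1ℤ
        go s ρ q j n w ss eq = begin
          s * (w + ρ)                                                        ≡⟨ solve (s ∷ ρ ∷ q ∷ n ∷ w ∷ []) ⟩
          s * (w + (ρ + q * (n + n)) - q * (n + n))                          ≡⟨ cong (λ t → s * (w + t - q * (n + n))) (sym eq) ⟩
          s * (w + (s * (j + j + 1ℤ) - w) - q * (n + n))                     ≡⟨ solve (s ∷ q ∷ j ∷ n ∷ w ∷ []) ⟩
          (s * s) * (j + j + 1ℤ) - s * q * (n + n)                           ≡⟨ cong (λ t → t * (j + j + 1ℤ) - s * q * (n + n)) ss ⟩
          1ℤ * (j + j + 1ℤ) - s * q * (n + n)                                ≡⟨ solve (s ∷ q ∷ j ∷ n ∷ []) ⟩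
          (j + (- (s * q)) * n) + (j + (- (s * q)) * n) + 1ℤ                 ∎
          where open ≡-Reasoning
      conclude : (∃[ k ] (w k ≡ v × w (suc k) ≡ v + 1ℤ)) →
                  Crossing j
      conclude (k , wk , wk+1) = go (orbit e₀ k) refl (at (midheight (orbit e₀ k)) wk)
        where
        rise : ∀ a b v → a ≡ v → a + b ≡ v + 1ℤ → b ≡ 1ℤ
        rise a b v refl eq = lin≡ (trans (cancel a b) (ℤₚ.i≡j⇒i-j≡0 eq))
          where
          cancel : ∀ a b → b - 1ℤ ≡ a + b - (a + 1ℤ)
          cancel a b = solve (a ∷ b ∷ [])
        up-step : dy (column (next (orbit e₀ k))) ≡ 1ℤ
        up-step = rise (w k) (dy (column (next (orbit e₀ k)))) v wk (trans (sym (w-step k)) wk+1)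
        go : ∀ e → orbit e₀ k ≡ e → midheight e ≡ j₀ + j₀ + 1ℤ →
             Crossing j
        -- Doubled midheights of horizontal edges are even, so the crossing takes place on a
        -- vertical edge.
        go (hor , i , j′) eq h = ⊥-elim (even≢odd j′ j₀ h)
        go (ver , i , j′) eq h = record
          { step    = k
          ; col     = i
          ; row     = j′
          ; at      = eq
          ; residue = trans (cong (reduce N) (half-≡ j′ j₀ (+1-injective (j′ + j′) (j₀ + j₀) h))) (reduce-+* N j (- (s * q)))
          ; rising  = trans (cong dy (sym (trans (cong (λ t → column (next t)) eq) (column-next (ver , i , j′))))) up-step
          }

    column-edge : ∀ k → proj₁ (tail N x y (edge L k)) ≡ column (orbit e₀ k)
    column-edge k = trans (cong (λ t → proj₁ (tail N x y t)) (sym (lifts k))) (column-tail (orbit e₀ k))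

    -- Barriers confine only what comes after a given edge; on a loop this is everything.
    reachable : ∀ n k → ∃[ d ] column (orbit (orbit e₀ n) d) ≡ column (orbit e₀ k)
    reachable n k with rewind L k n
    ... | d , eq = k ℕ.+ d , trans (cong column (sym (orbit-+ e₀ (k ℕ.+ d) n)))
      (trans (cong (λ t → column (orbit e₀ t)) (ℕₚ.+-assoc k d n))
        (trans (sym (column-edge (k ℕ.+ (d ℕ.+ n)))) (trans (cong (λ t → proj₁ (tail N x y t)) eq) (column-edge k))))

    level-crossing : ∀ {j} (cr : Crossing j) → let open Crossing cr in
                     level e₀ ≡ X (j + 1ℤ) + X (j + 1ℤ) - (Y col + (Y col + 1ℤ))
    level-crossing {j} cr = trans (sym (level-orbit e₀ step)) (trans (cong level at)
      (cong₂ (λ a b → a + a - (Y col + b)) (X-reduce (row + 1ℤ) (j + 1ℤ) (reduce-suc row j residue)) (trans (Y-step col) (cong (λ t → Y col + t) rising))))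
      where open Crossing cr

    module Extremes (low : Crossing jlo) (high : Crossing jhi) where

      module low = Crossing low
      module high = Crossing high
      m M : ℤ
      m = low.col
      M = high.col

      level-low : level e₀ ≡ lo + lo - (Y m + (Y m + 1ℤ))
      level-low = level-crossing low

      Y-last : Y (M + 1ℤ) ≡ Y M + 1ℤ
      Y-last = trans (Y-step M) (cong (λ t → Y M + t) high.rising)

      level-high : level e₀ ≡ hi + hi + 1ℤ - (Y (M + 1ℤ) + Y (M + 1ℤ))
      level-high = trans (level-crossing high) (trans (shift hi (Y M)) (cong (λ t → hi + hi + 1ℤ - (t + t)) (sym Y-last)))
        where
        shift : ∀ h y → h + h - (y + (y + 1ℤ)) ≡ h + h + 1ℤ - ((y + 1ℤ) + (y + 1ℤ))
        shift h y = solve (h ∷ y ∷ [])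

      low-column : column (orbit e₀ low.step) ≡ m
      low-column = cong column low.at

      high-column : column (orbit e₀ high.step) ≡ M
      high-column = cong column high.at

      meets-low : edge L low.step ≡ (ver , m , reduce N jlo)
      meets-low = trans (sym (lifts low.step)) (trans (cong project low.at)
        (cong (λ t → ver , m , t) low.residue))

      column≥m : ∀ k → m ≤ column (orbit e₀ k)
      column≥m k with reachable low.step k
      ... | d , eq = subst (m ≤_) eq (barrier-left (orbit e₀ low.step) m
        (subst (λ c → Barrier c m) (sym (trans (level-orbit e₀ low.step) level-low)) (low-barrier m))
        (ℤₚ.≤-reflexive (sym low-column)) d)

      column≤M : ∀ k → column (orbit e₀ k) ≤ M
      column≤M k with reachable high.step k
      ... | d , eq = <+1⇒≤ (subst (_< M + 1ℤ) eq (barrier-right (orbit e₀ high.step) (M + 1ℤ)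
        (subst (λ c → Barrier c (M + 1ℤ)) (sym (trans (level-orbit e₀ high.step) level-high)) (high-barrier (M + 1ℤ)))
        (subst (_< M + 1ℤ) (sym high-column) (≤⇒<+1 ℤₚ.≤-refl)) d))

      m≤M : m ≤ M
      m≤M = subst (_≤ M) low-column (column≤M low.step)

      bounding : BoundingCylinder L m M
      bounding = inCylinder L m M (λ k → subst (λ t → m ≤ t × t ≤ M) (sym (column-edge k)) (column≥m k , column≤M k)) ,
        λ m′ M′ inside →
          subst (m′ ≤_) (trans (column-edge low.step) low-column) (proj₁ (inside _ (low.step , inj₁ refl))) ,
          subst (_≤ M′) (trans (column-edge high.step) high-column) (proj₂ (inside _ (high.step , inj₁ refl)))

      -- Equate the two expressions for the level and substitute `hi = lo + r`.
      rise : Y (M + 1ℤ) ≡ Y m + r + 1ℤ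
      rise = half-≡ (Y (M + 1ℤ)) (Y m + r + 1ℤ) (go lo hi r (Y m) (Y (M + 1ℤ)) hi-lo (trans (sym level-low) level-high))
        where
        go : ∀ l h r a b → h ≡ l + r → l + l - (a + (a + 1ℤ)) ≡ h + h + 1ℤ - (b + b) → b + b ≡ (a + r + 1ℤ) + (a + r + 1ℤ)
        go l h r a b refl eq = lin≡ (trans (regroup l r a b) (ℤₚ.i≡j⇒i-j≡0 eq))
          where
          regroup : ∀ l r a b → b + b - ((a + r + 1ℤ) + (a + r + 1ℤ)) ≡ l + l - (a + (a + 1ℤ)) - ((l + r) + (l + r) + 1ℤ - (b + b))
          regroup l r a b = solve (l ∷ r ∷ a ∷ b ∷ [])

      -- The loop joins column m to column M, so it crosses between u − 1 and u.
      between : ∀ u → m < u → u ≤ M → ∃[ j ] X j + X (j + 1ℤ) - (Y u + Y u) ≡ level e₀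
      between u m<u u≤M = crossed (discrete-ivt (λ d → column (path d)) (λ d → column-step (path d)) (u - 1ℤ) (proj₁ reach)
          (subst (_≤ u - 1ℤ) (sym low-column) (before m u m<u))
          (subst (u - 1ℤ <_) (sym (trans (proj₂ reach) high-column)) (predecessor u M u≤M)))
        where
        path : ℕ → LiftedEdge
        path = orbit (orbit e₀ low.step)
        reach = reachable low.step high.step
        before : ∀ m u → m < u → m ≤ u - 1ℤ
        before m u p = lin≤ (gap< p) (solve (m ∷ u ∷ []))
        predecessor : ∀ u M → u ≤ M → u - 1ℤ < M
        predecessor u M p = lin< (gap p) (solve (u ∷ M ∷ []))
        crossed : (∃[ d ] (column (path d) ≡ u - 1ℤ × column (path (suc d)) ≡ u - 1ℤ + 1ℤ)) →
                  ∃[ j ] X j + X (j + 1ℤ) - (Y u + Y u) ≡ level e₀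
        crossed (d , c₀ , c₁) with straddling-level (straddles-rightward (path d) u
              (subst (_< u) (sym c₀) (predecessor u u ℤₚ.≤-refl))
              (ℤₚ.≤-reflexive (sym (trans c₁ (-1-cancel u)))))
        ... | j , eq = j , trans eq (trans (level-orbit (orbit e₀ low.step) d) (level-orbit e₀ low.step))

      -- For an edge passing at `u`, `X j + X (j + 1ℤ)` lies strictly between `lo + lo` and
      -- `hi + hi`. Comparing its level with those at the two ends puts `Y u` strictly between `Y m`
      -- and `Y (M + 1ℤ)`.
      interior : ∀ u → m < u → u ≤ M → Y m + 1ℤ ≤ Y u × Y u + 1ℤ ≤ Y (M + 1ℤ)
      interior u m<u u≤M = let j , at-u = between u m<u u≤M in
                       half-≤ (Y m + 1ℤ) (Y u) (below lo (X j) (X (j + 1ℤ)) (Y m) (Y u) (adjacent-lo j) (trans at-u level-low)) ,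
                       half-≤ (Y u + 1ℤ) (Y (M + 1ℤ)) (above hi (X j) (X (j + 1ℤ)) (Y (M + 1ℤ)) (Y u) (adjacent-hi j) (trans at-u level-high))
        where
        below : ∀ l a b m u → l + l + 1ℤ ≤ a + b → a + b - (u + u) ≡ l + l - (m + (m + 1ℤ)) → (m + 1ℤ) + (m + 1ℤ) ≤ u + u + 1ℤ
        below l a b m u p eq = lin≤ (gap p ⊹ gap≡ eq ⊹ (ℤ.+≤+ (z≤n {1}))) (solve (l ∷ a ∷ b ∷ m ∷ u ∷ []))
        above : ∀ h a b n u → a + b + 1ℤ ≤ h + h → a + b - (u + u) ≡ h + h + 1ℤ - (n + n) → (u + 1ℤ) + (u + 1ℤ) ≤ n + n + 1ℤ
        above h a b n u p eq = lin≤ (gap p ⊹ gap≡ (sym eq) ⊹ (ℤ.+≤+ (z≤n {1}))) (solve (h ∷ a ∷ b ∷ n ∷ u ∷ []))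

      overflow : Overflow m M
      overflow = m≤M , go r (Y m) (Y (M + 1ℤ)) rise
        where
        go : ∀ r a b → b ≡ a + r + 1ℤ → r < b - a
        go r a b eq = lin< (gap≡ (sym eq)) (solve (r ∷ a ∷ b ∷ []))

      left-bound : ∀ u → m ≤ u → u ≤ M → Y m ≤ Y u
      left-bound u m≤u u≤M with m ℤₚ.≟ u
      ... | yes refl = ℤₚ.≤-refl
      ... | no m≢u = ℤₚ.≤-trans (i≤i+1 (Y m)) (proj₁ (interior u (ℤₚ.≤∧≢⇒< m≤u m≢u) u≤M))

      right-bound : ∀ v → m ≤ v → v ≤ M → Y (v + 1ℤ) ≤ Y (M + 1ℤ)
      right-bound v m≤v v≤M with v ℤₚ.≟ M
      ... | yes refl = ℤₚ.≤-refl
      ... | no v≢M = ℤₚ.≤-trans (i≤i+1 (Y (v + 1ℤ))) (proj₂ (interior (v + 1ℤ) (≤⇒<+1 m≤v) (<⇒+1≤ (ℤₚ.≤∧≢⇒< v≤M v≢M))))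

      -- At an end that has moved, `interior` loses a full unit; at the other end the weak bound is
      -- enough.
      proper : ∀ m′ M′ → m ≤ m′ → m′ ≤ M′ → M′ ≤ M → (m′ ≢ m ⊎ M′ ≢ M) → ¬ Overflow m′ M′
      proper m′ M′ m≤m′ m′≤M′ M′≤M (inj₁ m′≢m) (_ , over) = shrunk-left r (Y m) (Y (M + 1ℤ)) (Y m′) (Y (M′ + 1ℤ)) rise
        (proj₁ (interior m′ (ℤₚ.≤∧≢⇒< m≤m′ (m′≢m ∘ sym)) (ℤₚ.≤-trans m′≤M′ M′≤M)))
        (right-bound M′ (ℤₚ.≤-trans m≤m′ m′≤M′) M′≤M) over
      proper m′ M′ m≤m′ m′≤M′ M′≤M (inj₂ M′≢M) (_ , over) = shrunk-right r (Y m) (Y (M + 1ℤ)) (Y m′) (Y (M′ + 1ℤ)) rise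
        (left-bound m′ m≤m′ (ℤₚ.≤-trans m′≤M′ M′≤M))
        (proj₂ (interior (M′ + 1ℤ) (≤⇒<+1 (ℤₚ.≤-trans m≤m′ m′≤M′)) (<⇒+1≤ (ℤₚ.≤∧≢⇒< M′≤M M′≢M)))) over

      minOverflow : MinOverflow m M
      minOverflow = overflow , proper

  -- The last component exhibits an edge that depends on `m` but not otherwise on the loop;
  -- uniqueness will rest on it.
  forward : (L : Loop N x y) → HasHomologyClass L s →
            ∃[ m ] ∃[ M ] (BoundingCylinder L m M × MinOverflow m M × ∃[ k ] edge L k ≡ (ver , m , reduce N jlo))
  forward L class = m , M , bounding , minOverflow , low.step , meets-low
    where
    open OfLoop L class
    open Extremes (crossing jlo) (crossing jhi)

  -- From a minimal overflow to a loop.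

  module OfOverflow (m M : ℤ) (minimal : MinOverflow m M) where

    m≤M : m ≤ M
    m≤M = proj₁ (proj₁ minimal)

    over : r < Y (M + 1ℤ) - Y m
    over = proj₂ (proj₁ minimal)

    proper : ∀ m′ M′ → m ≤ m′ → m′ ≤ M′ → M′ ≤ M → (m′ ≢ m ⊎ M′ ≢ M) → Y (M′ + 1ℤ) - Y m′ ≤ r
    proper m′ M′ p q o smaller = ℤₚ.≮⇒≥ (λ over′ → proj₂ minimal m′ M′ p q o smaller (q , over′))

    without-first : Y (M + 1ℤ) - Y (m + 1ℤ) ≤ r
    without-first with m ℤₚ.≟ M
    -- Minimality speaks of nonempty subsequences only; here the remainder is empty, with sum
    -- `0 ≤ r`.
    ... | yes m≡M = subst (_≤ r) (sym (trans (cong (λ t → Y (M + 1ℤ) - Y (t + 1ℤ)) m≡M) (ℤₚ.+-inverseʳ (Y (M + 1ℤ))))) 0≤r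
    ... | no m≢M = proper (m + 1ℤ) M (i≤i+1 m) (<⇒+1≤ (ℤₚ.≤∧≢⇒< m≤M m≢M)) ℤₚ.≤-refl
                     (inj₁ (λ eq → ℤₚ.<⇒≢ (≤⇒<+1 ℤₚ.≤-refl) (sym eq)))

    -- If the first term were -1, dropping it would increase the sum, contrary to `without-first`.
    dy-m : dy m ≡ 1ℤ
    dy-m = go r (Y m) (Y (m + 1ℤ)) (Y (M + 1ℤ)) (dy m) over without-first (Y-step m) (⟦⟧-product σ (y m))
      where
      clash : ∀ r a b → r < b - a → b - (a + -1ℤ) ≤ r → ⊥
      clash r a b p q = lin⊥ (gap< p ⊹ gap q ⊹ ℤ.+≤+ (z≤n {1})) (solve (r ∷ a ∷ b ∷ []))
      go : ∀ r a a′ b d → r < b - a → b - a′ ≤ r → a′ ≡ a + d → d ≡ 1ℤ ⊎ d ≡ -1ℤ → d ≡ 1ℤ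
      go r a a′ b d p q eq   (inj₁ d≡1)  = d≡1
      go r a a′ b d p q refl (inj₂ refl) = ⊥-elim (clash r a b p q)

    Y-first : Y (m + 1ℤ) ≡ Y m + 1ℤ
    Y-first = trans (Y-step m) (cong (λ t → Y m + t) dy-m)

    -- Overflow gives at least `r + 1`; dropping the first term, which is 1, leaves at most `r`.
    rise : Y (M + 1ℤ) ≡ Y m + r + 1ℤ
    rise = ℤₚ.≤-antisym (above r (Y m) (Y (m + 1ℤ)) (Y (M + 1ℤ)) without-first Y-first) (below r (Y m) (Y (M + 1ℤ)) over)
      where
      above : ∀ r a a′ b → b - a′ ≤ r → a′ ≡ a + 1ℤ → b ≤ a + r + 1ℤ
      above r a a′ b p q = lin≤ (gap p ⊹ gap≡ q) (solve (r ∷ a ∷ a′ ∷ b ∷ []))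
      below : ∀ r a b → r < b - a → a + r + 1ℤ ≤ b
      below r a b p = lin≤ (gap< p) (solve (r ∷ a ∷ b ∷ []))

    interior : ∀ u → m < u → u ≤ M → Y m + 1ℤ ≤ Y u
    interior u m<u u≤M = go r (Y m) (Y u) (Y (M + 1ℤ)) rise
        (proper u M (ℤₚ.<⇒≤ m<u) u≤M ℤₚ.≤-refl (inj₁ (λ eq → ℤₚ.<⇒≢ m<u (sym eq))))
      where
      go : ∀ r a u b → b ≡ a + r + 1ℤ → b - u ≤ r → a + 1ℤ ≤ u
      go r a u b p q = lin≤ (gap≡ (sym p) ⊹ gap q) (solve (r ∷ a ∷ u ∷ b ∷ []))

    interior-suc : ∀ i → m ≤ i → i ≤ M → Y m + 1ℤ ≤ Y (i + 1ℤ)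
    interior-suc i m≤i i≤M with i ℤₚ.≟ M
    ... | no i≢M   = interior (i + 1ℤ) (≤⇒<+1 m≤i) (<⇒+1≤ (ℤₚ.≤∧≢⇒< i≤M i≢M))
    ... | yes i≡M = subst (λ t → Y m + 1ℤ ≤ Y (t + 1ℤ)) (sym i≡M) (go r (Y m) (Y (M + 1ℤ)) 0≤r rise)
      where
      go : ∀ r a b → 0ℤ ≤ r → b ≡ a + r + 1ℤ → a + 1ℤ ≤ b
      go r a b p q = lin≤ (gap p ⊹ gap≡ (sym q)) (solve (r ∷ a ∷ b ∷ []))

    e₀ : LiftedEdge
    e₀ = ver , m , jlo

    level-low : level e₀ ≡ lo + lo - (Y m + (Y m + 1ℤ))
    level-low = cong (λ t → lo + lo - (Y m + t)) Y-first

    level-high : level e₀ ≡ hi + hi + 1ℤ - (Y (M + 1ℤ) + Y (M + 1ℤ))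
    level-high = trans level-low (go lo hi r (Y m) (Y (M + 1ℤ)) hi-lo rise)
      where
      go : ∀ l h r a b → h ≡ l + r → b ≡ a + r + 1ℤ → l + l - (a + (a + 1ℤ)) ≡ h + h + 1ℤ - (b + b)
      go l h r a b refl refl = solve (l ∷ r ∷ a ∷ [])

    bounds : ∀ k → m ≤ column (orbit e₀ k) × column (orbit e₀ k) ≤ M
    bounds k =
      barrier-left e₀ m (subst (λ c → Barrier c m) (sym level-low) (low-barrier m)) ℤₚ.≤-refl k ,
      <+1⇒≤ (barrier-right e₀ (M + 1ℤ) (subst (λ c → Barrier c (M + 1ℤ)) (sym level-high) (high-barrier (M + 1ℤ))) (≤⇒<+1 m≤M) k)

    -- In any other column both `Y i` and `Y (i + 1ℤ)` are at least `Y m + 1ℤ`, which makes the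
    -- level too small.
    only-crossing : ∀ i → m ≤ i → i ≤ M → lo + lo - (Y i + Y (i + 1ℤ)) ≡ level e₀ → i ≡ m
    only-crossing i m≤i i≤M eq with m ℤₚ.≟ i
    ... | yes m≡i = sym m≡i
    ... | no m≢i  = ⊥-elim (go lo (Y m) (Y i) (Y (i + 1ℤ)) (interior i (ℤₚ.≤∧≢⇒< m≤i m≢i) i≤M) (interior-suc i m≤i i≤M) (trans eq level-low))
      where
      go : ∀ l a b b′ → a + 1ℤ ≤ b → a + 1ℤ ≤ b′ → l + l - (b + b′) ≡ l + l - (a + (a + 1ℤ)) → ⊥
      go l a b b′ p q e = lin⊥ (gap p ⊹ gap q ⊹ gap≡ (sym e)) (solve (l ∷ a ∷ b ∷ b′ ∷ []))

    -- Within the columns m … M, the only edge of this level at the height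
    -- of e₀ is e₀ itself (up to deck transformations).
    same-height : ∀ e q → level e ≡ level e₀ → m ≤ column e → column e ≤ M →
                  midheight e ≡ midheight e₀ + q * (+ N + + N) → column e ≡ m × project e ≡ project e₀
    same-height (hor , i , j) q _ _ _ h = ⊥-elim (even≢odd j (jlo + q * + N) (trans h (odd-shift jlo q (+ N))))
    same-height (ver , i , j) q lev m≤i i≤M h = i≡m , cong₂ (λ a b → ver , a , b) i≡m reduce≡
      where
      j≡ : j ≡ jlo + q * + N
      j≡ = half-≡ j (jlo + q * + N) (+1-injective (j + j) ((jlo + q * + N) + (jlo + q * + N)) (trans h (odd-shift jlo q (+ N))))
      reduce≡ : reduce N j ≡ reduce N jlo
      reduce≡ = trans (cong (reduce N) j≡) (reduce-+* N jlo q)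
      i≡m : i ≡ m
      i≡m = only-crossing i m≤i i≤M (trans (cong (λ t → t + t - (Y i + Y (i + 1ℤ))) (X-reduce (jlo + 1ℤ) (j + 1ℤ) (reduce-suc jlo j (sym reduce≡)))) lev)

    midheight-project : ∀ e → project e ≡ project e₀ → ∃[ q ] midheight e ≡ midheight e₀ + q * (+ N + + N)
    midheight-project (hor , i , j) ()
    midheight-project (ver , i , j) eq = let q , j≡ = reduce-≡⇒ N j jlo (cong (λ t → proj₂ (proj₂ t)) eq) in q , go j jlo q (+ N) j≡
      where
      go : ∀ j j₀ q n → j ≡ j₀ + q * n → j + j + 1ℤ ≡ j₀ + j₀ + 1ℤ + q * (n + n)
      go j j₀ q n refl = sym (odd-shift j₀ q n)

    w : ℕ → ℤ
    w n = s * (midheight (orbit e₀ n) - midheight e₀)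

    w-step : ∀ n → w (suc n) ≡ w n + dy (column (orbit e₀ (suc n)))
    w-step n = trans (cong (λ t → s * (t - midheight e₀)) (midheight-next (orbit e₀ n)))
      (regroup s (midheight (orbit e₀ n)) ⟦ y (column (orbit e₀ (suc n))) ⟧ (midheight e₀))
      where
      regroup : ∀ s a d b → s * (a + d - b) ≡ s * (a - b) + s * d
      regroup s a d b = solve (s ∷ a ∷ d ∷ b ∷ [])

    w-start : w 1 ≡ 1ℤ
    w-start = trans (w-step 0) (cong₂ _+_ (zero-diff s (midheight e₀)) (trans (cong dy (column-next e₀)) dy-m))
      where
      zero-diff : ∀ s a → s * (a - a) ≡ 0ℤ
      zero-diff s a = solve (s ∷ a ∷ [])

    -- A multiple of `2 N` means the height of some translate of `e₀`, where `same-height` applies.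
    w-multiple : ∀ n t → w n ≡ t * (+ N + + N) → column (orbit e₀ n) ≡ m × project (orbit e₀ n) ≡ project e₀
    w-multiple n t eq = same-height (orbit e₀ n) (s * t) (level-orbit e₀ n) (proj₁ (bounds n)) (proj₂ (bounds n))
      (trans (regroup (midheight (orbit e₀ n)) (midheight e₀))
        (cong (λ u → midheight e₀ + u) (trans (sym (⟦⟧-cancel σ _)) (trans (cong (s *_) eq) (sym (ℤₚ.*-assoc s t (+ N + + N)))))))
      where
      regroup : ∀ a b → a ≡ b + (a - b)
      regroup a b = solve (a ∷ b ∷ [])

    1≤N+N : 1ℤ ≤ + N + + N
    1≤N+N = ℤ.+≤+ (ℕₚ.≤-trans (ℕ.>-nonZero⁻¹ N) (ℕₚ.m≤m+n N N))

    module Return (p : ℕ) (return : FirstReturn e₀ p) where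

      -- Up to its first return the path stays between the heights 1 and `2 N`: at `2 N` it has
      -- already returned, and it cannot step down to 0.
      climb : ∀ k → k ℕ.≤ p → 1ℤ ≤ w (suc k) × w (suc k) ≤ + N + + N
      climb zero    _   = ℤₚ.≤-reflexive (sym w-start) , subst (_≤ + N + + N) (sym w-start) 1≤N+N
      climb (suc k) k<p = lower , upper
        where
        ih = climb k (ℕₚ.<⇒≤ k<p)
        d = dy (column (orbit e₀ (suc (suc k))))
        not-yet : w (suc k) ≢ + N + + N
        not-yet eq = proj₂ return k k<p (proj₂ (w-multiple (suc k) 1ℤ (trans eq (sym (ℤₚ.*-identityˡ (+ N + + N))))))
        upper : w (suc (suc k)) ≤ + N + + N
        upper = go (w (suc k)) (w (suc (suc k))) d (+ N + + N) (w-step (suc k)) (dy≤1 _) (ℤₚ.≤∧≢⇒< (proj₂ ih) not-yet)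
          where
          go : ∀ a b d n → b ≡ a + d → d ≤ 1ℤ → a < n → b ≤ n
          go a b d n e p q = lin≤ (gap≡ e ⊹ gap p ⊹ gap< q) (solve (a ∷ b ∷ d ∷ n ∷ []))
        not-zero : d ≡ -1ℤ → w (suc (suc k)) ≢ 0ℤ
        -- At height 0 the path would be in column `m`, where steps go up, so it cannot have arrived
        -- by a step down.
        not-zero d≡-1 w≡0 = clash (trans (sym d≡-1) (trans (cong dy (proj₁ (w-multiple (suc (suc k)) 0ℤ (trans w≡0 (sym (ℤₚ.*-zeroˡ (+ N + + N))))))) dy-m))
          where
          clash : -1ℤ ≢ 1ℤ
          clash ()
        lower : 1ℤ ≤ w (suc (suc k))
        lower with ⟦⟧-product σ (y (column (orbit e₀ (suc (suc k)))))
        ... | inj₁ d≡1 = go (w (suc k)) (w (suc (suc k))) d (proj₁ ih) (w-step (suc k)) d≡1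
          where
          go : ∀ a b d → 1ℤ ≤ a → b ≡ a + d → d ≡ 1ℤ → 1ℤ ≤ b
          go a b d p q r = lin≤ (gap p ⊹ gap≡ (sym q) ⊹ gap≡ (sym r) ⊹ ℤ.+≤+ (z≤n {1})) (solve (a ∷ b ∷ d ∷ []))
        ... | inj₂ d≡-1 = ℤₚ.i<j⇒suc[i]≤j (ℤₚ.≤∧≢⇒< (go (w (suc k)) (w (suc (suc k))) d (proj₁ ih) (w-step (suc k)) d≡-1) (not-zero d≡-1 ∘ sym))
          where
          go : ∀ a b d → 1ℤ ≤ a → b ≡ a + d → d ≡ -1ℤ → 0ℤ ≤ b
          go a b d p q r = lin≤ (gap p ⊹ gap≡ (sym q) ⊹ gap≡ (sym r)) (solve (a ∷ b ∷ d ∷ []))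

      -- A return has a height that is a multiple of `2 N`, and `climb` leaves only one candidate.
      w-return : w (suc p) ≡ + N + + N
      w-return = let q , h = midheight-project (orbit e₀ (suc p)) (proj₁ return)
                     w≡ = trans (cong (λ t → s * (t - midheight e₀)) h) (regroup s (midheight e₀) q (+ N + + N))
                     lower , upper = climb p ℕₚ.≤-refl
                 in trans w≡ (unit-multiple (s * q) (N ℕ.+ N) 1≤N+N (subst (1ℤ ≤_) w≡ lower) (subst (_≤ + N + + N) w≡ upper))
        where
        regroup : ∀ s a q n → s * (a + q * n - a) ≡ s * q * n
        regroup s a q n = solve (s ∷ a ∷ q ∷ n ∷ [])

      loop : Loop N x y
      loop = orbit-loop e₀ p return

      loop-class : HasHomologyClass loop s
      loop-class = trans (sym (⟦⟧-cancel σ (Δy loop))) (cong (s *_) (half-≡ (s * Δy loop) (+ N)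
          (trans (sym (regroup s (midheight e₀) (Δy loop)))
            (trans (cong (λ t → s * (t - midheight e₀)) (sym (midheight-sum e₀ (suc p) (proj₁ return)))) w-return))))
        where
        regroup : ∀ s a d → s * (a + (d + d) - a) ≡ s * d + s * d
        regroup s a d = solve (s ∷ a ∷ d ∷ [])

      loop-inside : InCylinder loop m M
      loop-inside = inCylinder loop m M (λ k → subst (λ t → m ≤ t × t ≤ M) (sym (column-tail (orbit e₀ k))) (bounds k))

      -- By `forward`, the true bounding sequence overflows too; it lies within `m` to `M`, so by
      -- minimality it is all of it.
      loop-bounding : BoundingCylinder loop m M
      loop-bounding = fits (forward loop loop-class)
        where
        fits : (∃[ m′ ] ∃[ M′ ] (BoundingCylinder loop m′ M′ × MinOverflow m′ M′ × ∃[ k ] edge loop k ≡ (ver , m′ , reduce N jlo))) →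
               BoundingCylinder loop m M
        fits (m′ , M′ , bounding , (overflow , _) , _) with m′ ℤₚ.≟ m | M′ ℤₚ.≟ M
        ... | yes refl | yes refl = bounding
        ... | no m′≢m  | _        = ⊥-elim (proj₂ minimal m′ M′ (proj₁ inside) (proj₁ overflow) (proj₂ inside) (inj₁ m′≢m) overflow)
          where inside = proj₂ bounding m M loop-inside
        ... | yes _    | no M′≢M  = ⊥-elim (proj₂ minimal m′ M′ (proj₁ inside) (proj₁ overflow) (proj₂ inside) (inj₂ M′≢M) overflow)
          where inside = proj₂ bounding m M loop-inside

      loop-unique : (L′ : Loop N x y) → HasHomologyClass L′ s → BoundingCylinder L′ m M → SameLoop loop L′
      loop-unique L′ class bounding =
        let m′ , M′ , bounding′ , _ , k , meets = forward L′ class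
            m≡m′ = proj₁ (boundingCylinder-unique L′ bounding bounding′)
        in common-edge⇒same loop L′ 0 k (trans (cong (λ t → ver , t , reduce N jlo) m≡m′) (sym meets))

  backward : ∀ m M → MinOverflow m M →
             Σ (Loop N x y) λ L → HasHomologyClass L s × BoundingCylinder L m M ×
               ((L′ : Loop N x y) → HasHomologyClass L′ s → BoundingCylinder L′ m M → SameLoop L L′)
  backward m M minimal = loop , loop-class , loop-bounding , loop-unique
    where
    open OfOverflow m M minimal
    returning = first-return e₀ m M bounds
    open Return (proj₁ returning) (proj₂ returning)

  -- Translation into positive and negative overflow.

  Y-Sum : ∀ m M → Y (M + 1ℤ) - Y m ≡ s * Sum (ỹ y r) m M
  Y-Sum m M = trans (regroup s (Q (M + 1ℤ)) (Q m)) (cong (s *_) (sym (Sum-prefix (ỹ y r) m M)))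
    where
    regroup : ∀ s a b → s * a - s * b ≡ s * (a - b)
    regroup s a b = solve (s ∷ a ∷ b ∷ [])

map-minimal : {O O′ : ℤ → ℤ → Set} → (∀ {m M} → O m M → O′ m M) → (∀ {m M} → O′ m M → O m M) →
              ∀ {m M} → Minimal O m M → Minimal O′ m M
map-minimal to from (over , proper) = to over , λ m′ M′ p q o smaller over′ → proper m′ M′ p q o smaller (from over′)

module _ (N : ℕ) .{{nz : NonZero N}} (x : Fin N → Sign) (y : ℤ → Sign) (balanced : total N x ≡ 0ℤ)
         (r : ℤ) (range : IsRange N x r) where

  private
    module C (σ : Sign) = Core N x y balanced r range σ

  overflow⇒pos : ∀ {m M} → C.Overflow Sign.+ m M → PosOverflowing y r m M
  overflow⇒pos {m} {M} (m≤M , over) = m≤M , subst (r <_) (trans (C.Y-Sum Sign.+ m M) (ℤₚ.*-identityˡ (Sum (ỹ y r) m M))) over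

  pos⇒overflow : ∀ {m M} → PosOverflowing y r m M → C.Overflow Sign.+ m M
  pos⇒overflow {m} {M} (m≤M , over) = m≤M , subst (r <_) (sym (trans (C.Y-Sum Sign.+ m M) (ℤₚ.*-identityˡ (Sum (ỹ y r) m M)))) over

  overflow⇒neg : ∀ {m M} → C.Overflow Sign.- m M → NegOverflowing y r m M
  overflow⇒neg {m} {M} (m≤M , over) = m≤M , flip (Sum (ỹ y r) m M) r (subst (r <_) (C.Y-Sum Sign.- m M) over)
    where
    flip : ∀ a r → r < -1ℤ * a → a < - r
    flip a r p = lin< (gap< p) (solve (a ∷ r ∷ []))

  neg⇒overflow : ∀ {m M} → NegOverflowing y r m M → C.Overflow Sign.- m M
  neg⇒overflow {m} {M} (m≤M , over) = m≤M , subst (r <_) (sym (C.Y-Sum Sign.- m M)) (flip (Sum (ỹ y r) m M) r over)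
    where
    flip : ∀ a r → a < - r → r < -1ℤ * a
    flip a r p = lin< (gap< p) (solve (a ∷ r ∷ []))

theorem1p1 : (N : ℕ) .{{_ : NonZero N}} (x : Fin N → Sign) (y : ℤ → Sign) →
    total N x ≡ 0ℤ → (r : ℤ) → IsRange N x r →
    -- homology class 1
    ((L : Loop N x y) → HasHomologyClass L 1ℤ →
       ∃[ m ] ∃[ M ] (BoundingCylinder L m M × MinPosOverflowing y r m M)) ×
    ((m M : ℤ) → MinPosOverflowing y r m M →
       Σ (Loop N x y) (λ L → HasHomologyClass L 1ℤ × BoundingCylinder L m M ×
         ((L′ : Loop N x y) → HasHomologyClass L′ 1ℤ → BoundingCylinder L′ m M →
            SameLoop L L′))) ×
    -- homology class -1
    ((L : Loop N x y) → HasHomologyClass L -1ℤ →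
       ∃[ m ] ∃[ M ] (BoundingCylinder L m M × MinNegOverflowing y r m M)) ×
    ((m M : ℤ) → MinNegOverflowing y r m M →
       Σ (Loop N x y) (λ L → HasHomologyClass L -1ℤ × BoundingCylinder L m M ×
         ((L′ : Loop N x y) → HasHomologyClass L′ -1ℤ → BoundingCylinder L′ m M →
            SameLoop L L′)))
theorem1p1 N x y balanced r range =
    (λ L class → let m , M , bounding , minimal , _ = C.forward Sign.+ L class in
       m , M , bounding , map-minimal (overflow⇒pos N x y balanced r range) (pos⇒overflow N x y balanced r range) minimal) ,
    (λ m M minimal → C.backward Sign.+ m M
       (map-minimal (pos⇒overflow N x y balanced r range) (overflow⇒pos N x y balanced r range) minimal)) ,
    (λ L class → let m , M , bounding , minimal , _ = C.forward Sign.- L class in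
       m , M , bounding , map-minimal (overflow⇒neg N x y balanced r range) (neg⇒overflow N x y balanced r range) minimal) ,
    (λ m M minimal → C.backward Sign.- m M
       (map-minimal (neg⇒overflow N x y balanced r range) (overflow⇒neg N x y balanced r range) minimal))
  where module C (σ : Sign) = Core N x y balanced r range σ
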